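{- Let $(\mathcal{H},\mathcal{M})$ be a matroid-rooted mixed hypergraph with $\mathcal{H}=(V\cup R,\mathcal{A}\cup\mathcal{E})$ and $\mathcal{M}=(R,r_{\mathcal{M}})$. Then there exists a matroid-reachability-based packing of mixed hyperarborescences in $(\mathcal{H},\mathcal{M})$ if and only if for every strongly connected component $C$ of $\mathcal{H}-R$ and every biset subpartition $\{\mathsf{X}^i\}_{i=1}^{\ell}$ of $C$ such that $X_W^i=P^{\mathcal{H}}_{X_W^i}$ for all $i=1,\dots,\ell$, $$e_{\mathcal{E}}(\{X_I^i\}_{1}^{\ell})+\sum_{i=1}^{\ell} d^-_{\mathcal{A}}(\mathsf{X}^i)\geq \sum_{i=1}^{\ell}\bigl(r_{\mathcal{M}}(P^{\mathcal{H}}_C\cap R)-r_{\mathcal{M}}(X_W^i\cap R)\bigr).$$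
   Context: A mixed hypergraph $\mathcal{H}=(W,\mathcal{A}\cup\mathcal{E})$ has a finite vertex set $W$, a finite (multi)set $\mathcal{A}$ of dyperedges and a finite (multi)set $\mathcal{E}$ of hyperedges. A dyperedge $a$ is a pair $(tail(a),head(a))$ with $head(a)\in W$ and $\emptyset\neq tail(a)\subseteq W-head(a)$; a hyperedge is a subset of $W$ of size at least $2$. For $X\subseteq W$: a dyperedge $a$ enters $X$ if $head(a)\in X$ and $tail(a)-X\neq\emptyset$, and leaves $X$ if it enters $W-X$; a hyperedge enters $X$ if it meets both $X$ and $W-X$. A vertex $r$ is a root if no dyperedge and no hyperedge enters $\{r\}$ and every dyperedge leaving $\{r\}$ has tail exactly $\{r\}$. A matroid-rooted mixed hypergraph is a pair $(\mathcal{H},\mathcal{M})$ with $\mathcal{H}=(V\cup R,\mathcal{A}\cup\mathcal{E})$, $V\cap R=\emptyset$, every vertex of $R$ a root, and $\mathcal{M}$ a matroid on $R$ with rank function $r_{\mathcal{M}}$. Trimming a dyperedge $a$ means replacing it by an arc $uv$ with $v=head(a)$, $u\in tail(a)$; trimming a hyperedge $e$ means replacing it by an arc $uv$ with $u\neq v\in e$. A mixed hyperpath from $u$ to $v$ is a sub-mixed-hypergraph whose dyperedges and hyperedges can be trimmed to give a directed path from $u$ to $v$. For $X\subseteq W$, $P^{\mathcal{H}}_X$ is the set of vertices from which at least one vertex of $X$ is reachable by a mixed hyperpath in $\mathcal{H}$ ($X\subseteq P^{\mathcal{H}}_X$); $P^{\mathcal{H}}_v=P^{\mathcal{H}}_{\{v\}}$.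 $\mathcal{H}-R$ is the mixed hypergraph on $V$ consisting of the dyperedges and hyperedges of $\mathcal{H}$ contained in $V$; a strongly connected component of it is a maximal vertex set whose vertices are pairwise reachable from each other by mixed hyperpaths in $\mathcal{H}-R$. An $r$-arborescence is a digraph whose underlying graph is a tree, in which $r$ has in-degree $0$ and every other vertex has in-degree $1$ (possibly just $r$). A mixed $r$-hyperarborescence is a sub-mixed-hypergraph that can be trimmed to an $r$-arborescence. For $Z\subseteq Y\subseteq R$, $Z$ is a basis of $Y$ in $\mathcal{M}$ if $|Z|=r_{\mathcal{M}}(Z)=r_{\mathcal{M}}(Y)$. A matroid-reachability-based packing of mixed hyperarborescences is a family $\{\mathcal{B}_r\}_{r\in R}$ of mixed hyperarborescences in $\mathcal{H}$, pairwise sharing no dyperedge and no hyperedge, such that each $\mathcal{B}_r$ can be trimmed to an $r$-arborescence $B_r$ so that for every $v\in V$ the set $\{r\in R:v\in V(B_r)\}$ is a basis of $P^{\mathcal{H}}_v\cap R$ in $\mathcal{M}$. A biset is $\mathsf{X}=(X_O,X_I)$ with $X_I\subseteq X_O\subseteq V\cup R$; its wall is $X_W=X_O-X_I$. A dyperedge $a$ enters $\mathsf{X}$ if $head(a)\in X_I$ and $tail(a)-X_O\neq\emptyset$; $d^-_{\mathcal{A}}(\mathsf{X})$ is the number of such dyperedges. For $C\subseteq V\cup R$, a biset subpartition of $C$ is a family $\{\mathsf{X}^i\}_{i=1}^{\ell}$ of bisets with the $X_I^i$ nonempty, pairwise disjoint subsets of $C$ and $X_W^i\subseteq(V\cup R)-C$.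 $e_{\mathcal{E}}(\{X_I^i\}_1^\ell)$ is the number of hyperedges entering at least one $X_I^i$. -}

module Defs where

open import Data.Bool using (Bool; true; false; _∧_; _∨_; not; if_then_else_)
open import Data.Nat using (ℕ; zero; suc; _+_)
open import Data.Integer using (ℤ; +_; _-_) renaming (_+_ to _+ℤ_; _≤_ to _≤ℤ_)
open import Data.Fin using (Fin; zero; suc; _≟_)
open import Data.Fin.Subset using (Subset; _∈_; _∉_; _⊆_; ∁; _∩_; _∪_; _─_; ⁅_⁆; ∣_∣; Nonempty; ⊥)
open import Data.Vec using (Vec; lookup; tabulate; foldr; zipWith)
open import Data.List using (List; []; _∷_; length; filter; _++_; mapMaybe; allFin)
open import Data.List.Membership.Propositional using () renaming (_∈_ to _∈ₗ_)
open import Data.Maybe using (Maybe; just; nothing)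
open import Data.Product using (Σ; ∃; ∃-syntax; _×_; _,_; proj₁; proj₂)
open import Data.Sum using (_⊎_)
open import Relation.Binary.PropositionalEquality using (_≡_; _≢_)
open import Relation.Binary.Construct.Closure.ReflexiveTransitive using (Star)
open import Relation.Nullary using (¬_; yes; no)
open import Relation.Nullary.Decidable using (⌊_⌋)
open import Function using (_⇔_)

_∈ᵇ_ : ∀ {n} → Fin n → Subset n → Bool
x ∈ᵇ X = lookup X x

meetsᵇ : ∀ {n} → Subset n → Subset n → Bool
meetsᵇ X Y = foldr _ _∨_ false (zipWith _∧_ X Y)

anyFin : ∀ {m} → (Fin m → Bool) → Bool
anyFin {zero} f = false
anyFin {suc m} f = f zero ∨ anyFin (λ i → f (suc i))

count : ∀ {m} → (Fin m → Bool) → ℕ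
count {zero} f = 0
count {suc m} f = (if f zero then 1 else 0) + count (λ i → f (suc i))

sumℕ : ∀ {m} → (Fin m → ℕ) → ℕ
sumℕ {zero} f = 0
sumℕ {suc m} f = f zero + sumℕ (λ i → f (suc i))

sumℤ : ∀ {m} → (Fin m → ℤ) → ℤ
sumℤ {zero} f = + 0
sumℤ {suc m} f = f zero +ℤ sumℤ (λ i → f (suc i))

-- Mixed hypergraphs on the vertex set W = Fin n.
-- Dyperedges are indexed by Fin nA (a multiset), hyperedges by Fin nE.

record MixedHypergraph (n : ℕ) : Set where
  field
    nA   : ℕ
    tl   : Fin nA → Subset n
    hd   : Fin nA → Fin n
    nE   : ℕ
    he   : Fin nE → Subset n
    tl-nonempty : ∀ a → Nonempty (tl a)
    hd∉tl       : ∀ a → hd a ∉ tl a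
    he-size     : ∀ e → 2 Data.Nat.≤ ∣ he e ∣

open MixedHypergraph public

module _ {n : ℕ} (H : MixedHypergraph n) where

  dyEntersᵇ : Fin (nA H) → Subset n → Bool
  dyEntersᵇ a X = (hd H a ∈ᵇ X) ∧ meetsᵇ (tl H a) (∁ X)

  dyLeavesᵇ : Fin (nA H) → Subset n → Bool
  dyLeavesᵇ a X = dyEntersᵇ a (∁ X)

  heEntersᵇ : Fin (nE H) → Subset n → Bool
  heEntersᵇ e X = meetsᵇ (he H e) X ∧ meetsᵇ (he H e) (∁ X)

  IsRoot : Fin n → Set
  IsRoot r = (∀ a → dyEntersᵇ a ⁅ r ⁆ ≡ false)
           × (∀ e → heEntersᵇ e ⁅ r ⁆ ≡ false)
           × (∀ a → dyLeavesᵇ a ⁅ r ⁆ ≡ true → tl H a ≡ ⁅ r ⁆)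

  -- one trimmed step u → w: an arc uw obtained by trimming a dyperedge
  -- (u ∈ tail, w = head) or a hyperedge (u ≠ w both in it)
  Step : Fin n → Fin n → Set
  Step u w = (∃[ a ] (u ∈ tl H a × hd H a ≡ w))
           ⊎ (∃[ e ] (u ∈ he H e × w ∈ he H e × u ≢ w))

  Reach : Fin n → Fin n → Set
  Reach = Star Step

  InP : Subset n → Fin n → Set
  InP X u = ∃[ x ] (x ∈ X × Reach u x)

  IsPcapR : Subset n → Subset n → Subset n → Set
  IsPcapR R X Y = ∀ v → (v ∈ Y) ⇔ (v ∈ R × InP X v)

  -- trimmed steps inside H - R (only dyperedges/hyperedges contained in V = W - R)
  StepV : Subset n → Fin n → Fin n → Set
  StepV R u w = (∃[ a ] (tl H a ⊆ ∁ R × hd H a ∈ ∁ R × u ∈ tl H a × hd H a ≡ w))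
              ⊎ (∃[ e ] (he H e ⊆ ∁ R × u ∈ he H e × w ∈ he H e × u ≢ w))

  ReachV : Subset n → Fin n → Fin n → Set
  ReachV R = Star (StepV R)

  IsSCC : Subset n → Subset n → Set
  IsSCC R C = Nonempty C
            × C ⊆ ∁ R
            × (∀ u v → u ∈ C → v ∈ C → ReachV R u v)
            × (∀ u v → u ∈ C → v ∈ ∁ R → ReachV R u v → ReachV R v u → v ∈ C)

record Matroid {n : ℕ} (R : Subset n) : Set where
  field
    rank     : Subset n → ℕ
    rank-≤   : ∀ X → X ⊆ R → rank X Data.Nat.≤ ∣ X ∣
    rank-mono : ∀ X Y → Y ⊆ R → X ⊆ Y → rank X Data.Nat.≤ rank Y
    rank-submod : ∀ X Y → X ⊆ R → Y ⊆ R →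
                  rank (X ∪ Y) + rank (X ∩ Y) Data.Nat.≤ rank X + rank Y

open Matroid public

IsBasis : ∀ {n} {R : Subset n} → Matroid R → Subset n → Subset n → Set
IsBasis M Z Y = Z ⊆ Y × ∣ Z ∣ ≡ rank M Z × rank M Z ≡ rank M Y

-- matroid-rooted mixed hypergraph: every vertex of R is a root
-- (V is the complement of R, so V ∩ R = ∅ and W = V ∪ R)
IsMatroidRooted : ∀ {n} → MixedHypergraph n → Subset n → Set
IsMatroidRooted H R = ∀ r → r ∈ R → IsRoot H r

Arc : ℕ → Set
Arc n = Fin n × Fin n

indeg : ∀ {n} → List (Arc n) → Fin n → ℕ
indeg arcs v = length (filter (λ p → proj₂ p ≟ v) arcs)

UAdj : ∀ {n} → List (Arc n) → Fin n → Fin n → Set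
UAdj arcs x y = ((x , y) ∈ₗ arcs) ⊎ ((y , x) ∈ₗ arcs)

-- (U, arcs) is an r-arborescence: underlying graph a tree (connected with
-- |arcs| = |U| - 1), r of in-degree 0, every other vertex of in-degree 1
IsArborescence : ∀ {n} → Fin n → Subset n → List (Arc n) → Set
IsArborescence r U arcs =
    r ∈ U
  × (∀ u v → (u , v) ∈ₗ arcs → u ∈ U × v ∈ U)
  × (∀ v → v ∈ U → Star (UAdj arcs) r v)
  × length arcs + 1 ≡ ∣ U ∣
  × indeg arcs r ≡ 0
  × (∀ v → v ∈ U → v ≢ r → indeg arcs v ≡ 1)

-- Packings.  A packing assigns every dyperedge / hyperedge to at most one
-- root r (so the B_r share no dyperedge or hyperedge), together with its
-- trimming; the trimmed arcs for r form the r-arborescence B_r on vertex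
-- set verts r.

module _ {n : ℕ} (H : MixedHypergraph n) where

  rootArcs : (Fin (nA H) → Maybe (Fin n × Fin n))
           → (Fin (nE H) → Maybe (Fin n × Fin n × Fin n))
           → Fin n → List (Arc n)
  rootArcs dy hy r =
      mapMaybe (λ a → f a (dy a)) (allFin (nA H))
   ++ mapMaybe (λ e → g (hy e)) (allFin (nE H))
    where
      f : Fin (nA H) → Maybe (Fin n × Fin n) → Maybe (Arc n)
      f a nothing = nothing
      f a (just (r' , u)) = if ⌊ r' ≟ r ⌋ then just (u , hd H a) else nothing
      g : Maybe (Fin n × Fin n × Fin n) → Maybe (Arc n)
      g nothing = nothing
      g (just (r' , u , v)) = if ⌊ r' ≟ r ⌋ then just (u , v) else nothing

  record Packing (R : Subset n) (M : Matroid R) : Set where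
    field
      -- dyperedge a ↦ just (r , u) : a ∈ B_r, trimmed to the arc u head(a)
      dyAssign : Fin (nA H) → Maybe (Fin n × Fin n)
      -- hyperedge e ↦ just (r , u , v) : e ∈ B_r, trimmed to the arc uv
      hyAssign : Fin (nE H) → Maybe (Fin n × Fin n × Fin n)
      verts    : Fin n → Subset n
      dy-valid : ∀ a r u → dyAssign a ≡ just (r , u) → r ∈ R × u ∈ tl H a
      hy-valid : ∀ e r u v → hyAssign e ≡ just (r , u , v) →
                 r ∈ R × u ∈ he H e × v ∈ he H e × u ≢ v
      arb      : ∀ r → r ∈ R → IsArborescence r (verts r) (rootArcs dyAssign hyAssign r)
      basis    : ∀ v → v ∉ R → ∀ Y → IsPcapR H R ⁅ v ⁆ Y →
                 IsBasis M (tabulate (λ r → (r ∈ᵇ R) ∧ (v ∈ᵇ verts r))) Y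

record BisetSubpartition {n : ℕ} (C : Subset n) : Set where
  field
    ℓ  : ℕ
    XO : Fin ℓ → Subset n
    XI : Fin ℓ → Subset n
    XI⊆XO    : ∀ i → XI i ⊆ XO i
    XI-ne    : ∀ i → Nonempty (XI i)
    XI⊆C     : ∀ i → XI i ⊆ C
    XI-disj  : ∀ i j → i ≢ j → ∀ x → x ∈ XI i → x ∉ XI j
    XW⊆∁C    : ∀ i → (XO i ─ XI i) ⊆ ∁ C

  XW : Fin ℓ → Subset n
  XW i = XO i ─ XI i

open BisetSubpartition public

module _ {n : ℕ} (H : MixedHypergraph n) where

  dIn : Subset n → Subset n → ℕ
  dIn XOut XIn = count (λ a → (hd H a ∈ᵇ XIn) ∧ meetsᵇ (tl H a) (∁ XOut))

  eE : ∀ {ℓ} → (Fin ℓ → Subset n) → ℕ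
  eE Xs = count (λ e → anyFin (λ i → heEntersᵇ H e (Xs i)))

module Submission where

-- Necessity.  Let r lie in the basis of a vertex of X_I but outside the predecessor-closed wall X_W. The
-- path of the r-arborescence to that vertex avoids X_W, so one of its arcs enters the biset X. The basis is
-- independent, so there are at least r_M(P_C ∩ R) − r_M(X_W ∩ R) such r, and each dyperedge or hyperedge
-- carries at most one arc, hence is counted once.
--
-- Sufficiency.  First every hyperedge e is given a head. If no head in e were legal, each w ∈ e would have a
-- biset subpartition that violates the condition once e is deleted and whose inner sets avoid w; uncrossing
-- such a family with one that contains w produces a violating family with fewer vertices of e, which cannot
-- go on. Now the condition concerns single bisets of a directed structure.
--
-- Then all arborescences grow simultaneously from their roots. Let S v be the set of roots whose tree contains
-- v. A growth step uses a free dyperedge a and some r ∈ S u with u ∈ tail a and r ∉ span S (head a), and adds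
-- head a to the tree of r. It keeps the condition unless a tight biset entered by a already spans r. In the
-- first component C that is not saturated, P_C is tight; every tight biset with an unsaturated vertex contains
-- such a step, and a blocking tight biset meets it in a smaller tight biset with an unsaturated vertex, so an
-- unblocked step exists. When every S v spans P_v ∩ R, the trees form the packing.

open import Defs
open import Data.Bool using (Bool; true; false; _∧_; _∨_; not; if_then_else_)
import Data.Bool as Bool
open import Data.Bool.ListAction using (any)
import Data.Empty as Empty
open import Data.Empty using (⊥-elim)
open import Data.Fin using (Fin; zero; suc; _≟_; _↑ˡ_; _↑ʳ_; splitAt)
import Data.Fin.Properties as Fin
open import Data.Fin.Properties using (any?; all?; splitAt-↑ˡ; splitAt-↑ʳ)
open import Data.Fin.Subset using (Subset; _∈_; _∉_; _⊆_; ∁; _∩_; _∪_; _─_; ⁅_⁆; ∣_∣; ⊥)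
import Data.Fin.Subset as Subset
open import Data.Fin.Subset.Properties
open import Data.Integer using (ℤ)
import Data.Integer as ℤ
import Data.Integer.Properties as ℤ
import Data.Integer.Tactic.RingSolver as ℤ-Solver
open import Data.List using (List; []; _∷_; length; _++_; map; mapMaybe; catMaybes; allFin; filter)
import Data.List as List
open import Data.List.Properties using (length-++; filter-++; filter-none; map-++; map-tabulate; tabulate-cong)
open import Data.List.Membership.Propositional using (find; lose) renaming (_∈_ to _∈ₗ_)
open import Data.List.Membership.Propositional.Properties using (∈-++⁺ˡ; ∈-++⁺ʳ; ∈-++⁻; ∈-lookup; ∈-filter⁺)
open import Data.List.Relation.Unary.All as All using (All; []; _∷_)
import Data.List.Relation.Unary.All.Properties as All
open import Data.List.Relation.Unary.AllPairs using (AllPairs; []; _∷_)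
import Data.List.Relation.Unary.AllPairs.Properties as AllPairs
open import Data.List.Relation.Unary.Any as Any using (here; there)
open import Data.Maybe using (Maybe; just; nothing; is-nothing)
import Data.Maybe as Maybe
open import Data.Nat using (ℕ) renaming (_+_ to _+ℕ_)
open import Data.Product using (∃; ∃-syntax; _×_; _,_; proj₁; proj₂)
open import Data.Sum using (_⊎_; inj₁; inj₂; [_,_]′)
open import Data.Vec using (Vec; []; _∷_; lookup; tabulate)
import Data.Vec as Vec
open import Data.Vec.Functional using (updateAt)
open import Data.Vec.Functional.Properties using (updateAt-updates; updateAt-minimal)
open import Data.Vec.Properties using (lookup∘tabulate; []=⇒lookup; lookup⇒[]=)
open import Function using (_⇔_; _∘_; Equivalence; mk⇔)
open import Induction.WellFounded using (Acc; acc)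
open import Relation.Binary.Construct.Closure.ReflexiveTransitive using (Star; ε; _◅_; _◅◅_)
open import Relation.Binary.PropositionalEquality using (_≡_; _≢_; refl; sym; trans; cong; cong₂; subst; subst₂; _≗_)
open import Relation.Nullary using (¬_; Dec; yes; no; does)
open import Relation.Nullary.Decidable using (map′; _×-dec_; _⊎-dec_; _→-dec_; ¬?; decidable-stable; dec-true; dec-false; ⌊_⌋)

module PackingTheory where

  open import Data.Nat using (zero; suc; _+_; _*_; _≤_; _<_; z≤n; s≤s; _≤?_; _<?_)
  open import Data.Nat.Induction using (<-wellFounded)
  open import Data.Nat.ListAction using (sum)
  open import Data.Nat.ListAction.Properties using (sum-++)
  open import Data.Nat.Properties hiding (_≟_)
  open import Data.Nat.Tactic.RingSolver using (solve-∀)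

  -- Indicators, counting and finite sums.

  𝟙 : Bool → ℕ
  𝟙 b = if b then 1 else 0

  𝟙≤1 : ∀ b → 𝟙 b ≤ 1
  𝟙≤1 true  = s≤s z≤n
  𝟙≤1 false = z≤n

  𝟙-mono : ∀ p q → (p ≡ true → q ≡ true) → 𝟙 p ≤ 𝟙 q
  𝟙-mono false q     f = z≤n
  𝟙-mono true  true  f = s≤s z≤n
  𝟙-mono true  false f with () ← f refl

  -- Pointwise core of the submodular counts: `p`, `q` stand for union and intersection, `r`, `s`
  -- for the two given sets or families.
  𝟙-exchange : ∀ p q r s →
    (p ≡ true → r ≡ true ⊎ s ≡ true) → (q ≡ true → r ≡ true ⊎ s ≡ true) →
    (p ≡ true → q ≡ true → r ≡ true × s ≡ true) →
    𝟙 p + 𝟙 q ≤ 𝟙 r + 𝟙 s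
  𝟙-exchange false false r     s     f g h = z≤n
  𝟙-exchange false true  true  s     f g h = s≤s z≤n
  𝟙-exchange false true  false true  f g h = s≤s z≤n
  𝟙-exchange false true  false false f g h with g refl
  ... | inj₁ ()
  ... | inj₂ ()
  𝟙-exchange true  false true  s     f g h = s≤s z≤n
  𝟙-exchange true  false false true  f g h = s≤s z≤n
  𝟙-exchange true  false false false f g h with f refl
  ... | inj₁ ()
  ... | inj₂ ()
  𝟙-exchange true  true  r     s     f g h with h refl refl
  ... | refl , refl = s≤s (s≤s z≤n)

  ∧-true⁻ : ∀ p q → p ∧ q ≡ true → p ≡ true × q ≡ true
  ∧-true⁻ true true _ = refl , refl

  ∧-true⁺ : ∀ {p q} → p ≡ true → q ≡ true → p ∧ q ≡ true
  ∧-true⁺ refl refl = refl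

  ∨-true⁻ : ∀ p q → p ∨ q ≡ true → p ≡ true ⊎ q ≡ true
  ∨-true⁻ true  q    _ = inj₁ refl
  ∨-true⁻ false true _ = inj₂ refl

  true-or-false : ∀ b → b ≡ true ⊎ b ≡ false
  true-or-false true  = inj₁ refl
  true-or-false false = inj₂ refl

  true≢false : ∀ {b} {A : Set} → b ≡ true → b ≡ false → A
  true≢false refl ()

  +-interchange : ∀ a b c d → (a + b) + (c + d) ≡ (a + c) + (b + d)
  +-interchange = solve-∀

  +-exchange-≤ : ∀ {a b c d a′ b′ c′ d′} → a + b ≤ c + d → a′ + b′ ≤ c′ + d′ →
    (a + a′) + (b + b′) ≤ (c + c′) + (d + d′)
  +-exchange-≤ {a} {b} {c} {d} {a′} {b′} {c′} {d′} p q
    rewrite +-interchange a a′ b b′ | +-interchange c c′ d d′ = +-mono-≤ p q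

  sum-map-+ : ∀ {A : Set} (f g : A → ℕ) L → sum (map (λ x → f x + g x) L) ≡ sum (map f L) + sum (map g L)
  sum-map-+ f g [] = refl
  sum-map-+ f g (x ∷ L) rewrite sum-map-+ f g L = +-interchange (f x) (g x) _ _

  count-mono : ∀ {m} {p q : Fin m → Bool} → (∀ i → p i ≡ true → q i ≡ true) → count p ≤ count q
  count-mono {zero} f = z≤n
  count-mono {suc m} f = +-mono-≤ (𝟙-mono _ _ (f zero)) (count-mono (f ∘ suc))

  count-cong : ∀ {m} {p q : Fin m → Bool} → p ≗ q → count p ≡ count q
  count-cong {zero} f = refl
  count-cong {suc m} f = cong₂ _+_ (cong 𝟙 (f zero)) (count-cong (f ∘ suc))

  count-false : ∀ {m} {p : Fin m → Bool} → (∀ i → p i ≡ false) → count p ≡ 0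
  count-false {zero} f = refl
  count-false {suc m} f rewrite f zero = count-false (f ∘ suc)

  count-exchange : ∀ {m} {p q r s : Fin m → Bool} →
    (∀ i → 𝟙 (p i) + 𝟙 (q i) ≤ 𝟙 (r i) + 𝟙 (s i)) → count p + count q ≤ count r + count s
  count-exchange {zero} f = z≤n
  count-exchange {suc m} {p} {q} {r} {s} f =
    +-exchange-≤ {𝟙 (p zero)} {𝟙 (q zero)} {𝟙 (r zero)} {𝟙 (s zero)} (f zero) (count-exchange (f ∘ suc))

  count-strict : ∀ {m} {p q : Fin m → Bool} → (∀ i → p i ≡ true → q i ≡ true) →
    ∀ i → p i ≡ false → q i ≡ true → suc (count p) ≤ count q
  count-strict f zero    e e′ rewrite e | e′ = s≤s (count-mono (f ∘ suc))
  count-strict {p = p} {q} f (suc i) e e′ =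
    subst (_≤ count q) (+-suc (𝟙 (p zero)) _) (+-mono-≤ (𝟙-mono _ _ (f zero)) (count-strict (f ∘ suc) i e e′))

  count-remove : ∀ {m} {p q : Fin m → Bool} a → (∀ i → i ≢ a → p i ≡ true → q i ≡ true) → count p ≤ suc (count q)
  count-remove {suc m} {p} {q} zero f =
    +-mono-≤ (𝟙≤1 (p zero)) (≤-trans (count-mono (λ i → f (suc i) (λ ()))) (m≤n+m _ (𝟙 (q zero))))
  count-remove {suc m} {p} {q} (suc a) f = subst (count p ≤_) (+-suc (𝟙 (q zero)) _)
    (+-mono-≤ (𝟙-mono _ _ (f zero (λ ()))) (count-remove a (λ i i≢a → f (suc i) (i≢a ∘ Fin.suc-injective))))

  count-↑ : ∀ m {k} (p : Fin (m + k) → Bool) → count p ≡ count (λ i → p (i ↑ˡ k)) + count (λ i → p (m ↑ʳ i))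
  count-↑ zero p = refl
  count-↑ (suc m) p rewrite count-↑ m (p ∘ suc) = sym (+-assoc (𝟙 (p zero)) _ _)

  count-positive : ∀ {m} {p : Fin m → Bool} i → p i ≡ true → 1 ≤ count p
  count-positive zero    e rewrite e = s≤s z≤n
  count-positive {p = p} (suc i) e = ≤-trans (count-positive i e) (m≤n+m _ (𝟙 (p zero)))

  count-≤1 : ∀ {m} {p : Fin m → Bool} → (∀ i j → p i ≡ true → p j ≡ true → i ≡ j) → count p ≤ 1
  count-≤1 {zero} u = z≤n
  count-≤1 {suc m} {p} u with true-or-false (p zero)
  ... | inj₁ e rewrite e | count-false {p = p ∘ suc}
        (λ i → [ (λ t → ⊥-elim (Fin.0≢1+n (u zero (suc i) e t))) , (λ f → f) ]′ (true-or-false (p (suc i)))) = ≤-refl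
  ... | inj₂ e rewrite e = count-≤1 (λ i j a b → Fin.suc-injective (u (suc i) (suc j) a b))

  sumℕ-mono : ∀ {m} {f g : Fin m → ℕ} → (∀ i → f i ≤ g i) → sumℕ f ≤ sumℕ g
  sumℕ-mono {zero} h = z≤n
  sumℕ-mono {suc m} h = +-mono-≤ (h zero) (sumℕ-mono (h ∘ suc))

  sumℕ-+ : ∀ {m} (f g : Fin m → ℕ) → sumℕ (λ i → f i + g i) ≡ sumℕ f + sumℕ g
  sumℕ-+ {zero} f g = refl
  sumℕ-+ {suc m} f g rewrite sumℕ-+ (f ∘ suc) (g ∘ suc) = +-interchange (f zero) (g zero) _ _

  sumℕ-0 : ∀ m → sumℕ {m} (λ _ → 0) ≡ 0
  sumℕ-0 zero = refl
  sumℕ-0 (suc m) = sumℕ-0 m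

  count≡sumℕ : ∀ {m} (p : Fin m → Bool) → count p ≡ sumℕ (𝟙 ∘ p)
  count≡sumℕ {zero} p = refl
  count≡sumℕ {suc m} p = cong (𝟙 (p zero) +_) (count≡sumℕ (p ∘ suc))

  sumℕ-swap : ∀ {m k} (f : Fin m → Fin k → ℕ) →
    sumℕ (λ i → sumℕ (λ j → f i j)) ≡ sumℕ (λ j → sumℕ (λ i → f i j))
  sumℕ-swap {zero} {k} f = sym (sumℕ-0 k)
  sumℕ-swap {suc m} f rewrite sumℕ-swap (f ∘ suc) = sym (sumℕ-+ (f zero) _)

  sumℕ-count-swap : ∀ {m k} (f : Fin m → Fin k → Bool) →
    sumℕ (λ i → count (f i)) ≡ sumℕ (λ j → count (λ i → f i j))
  sumℕ-count-swap f = trans (sumℕ-cong (λ i → count≡sumℕ (f i)))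
    (trans (sumℕ-swap (λ i j → 𝟙 (f i j))) (sumℕ-cong (λ j → sym (count≡sumℕ (λ i → f i j)))))
    where
    sumℕ-cong : ∀ {m} {f g : Fin m → ℕ} → f ≗ g → sumℕ f ≡ sumℕ g
    sumℕ-cong {zero} h = refl
    sumℕ-cong {suc m} h = cong₂ _+_ (h zero) (sumℕ-cong (h ∘ suc))

  anyFin⁺ : ∀ {m} (p : Fin m → Bool) i → p i ≡ true → anyFin p ≡ true
  anyFin⁺ p zero    e rewrite e = refl
  anyFin⁺ p (suc i) e with p zero
  ... | true  = refl
  ... | false = anyFin⁺ (p ∘ suc) i e

  anyFin⁻ : ∀ {m} (p : Fin m → Bool) → anyFin p ≡ true → ∃[ i ] p i ≡ true
  anyFin⁻ {suc m} p e with ∨-true⁻ (p zero) _ e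
  ... | inj₁ t = zero , t
  ... | inj₂ t = let i , u = anyFin⁻ (p ∘ suc) t in suc i , u

  -- Finite subsets and their membership tests.

  module _ {n : ℕ} where

    comprehension : {P : Fin n → Set} → (∀ x → Dec (P x)) → Subset n
    comprehension P? = tabulate (λ x → does (P? x))

    ∈-comprehension⁺ : {P : Fin n → Set} (P? : ∀ x → Dec (P x)) → ∀ {x} → P x → x ∈ comprehension P?
    ∈-comprehension⁺ P? {x} px =
      lookup⇒[]= x _ (trans (lookup∘tabulate _ x) (dec-true (P? x) px))

    ∈-comprehension⁻ : {P : Fin n → Set} (P? : ∀ x → Dec (P x)) → ∀ {x} → x ∈ comprehension P? → P x
    ∈-comprehension⁻ P? {x} x∈ with P? x | trans (sym (lookup∘tabulate (λ y → does (P? y)) x)) ([]=⇒lookup x∈)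
    ... | yes px | _ = px

    ∈ᵇ⁻ : ∀ {x} {X : Subset n} → (x ∈ᵇ X) ≡ true → x ∈ X
    ∈ᵇ⁻ {x} {X} e = lookup⇒[]= x X e

    ∈ᵇ⁺ : ∀ {x} {X : Subset n} → x ∈ X → (x ∈ᵇ X) ≡ true
    ∈ᵇ⁺ = []=⇒lookup

    ∩⁻ : ∀ {x} {X Y : Subset n} → x ∈ X ∩ Y → x ∈ X × x ∈ Y
    ∩⁻ {X = X} {Y} = x∈p∩q⁻ X Y

    ∪⁻ : ∀ {x} {X Y : Subset n} → x ∈ X ∪ Y → x ∈ X ⊎ x ∈ Y
    ∪⁻ {X = X} {Y} = x∈p∪q⁻ X Y

    ─⁻ : ∀ {x} {X Y : Subset n} → x ∈ X ─ Y → x ∈ X × x ∉ Y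
    ─⁻ {X = X} {Y} x∈ = p─q⊆p X Y x∈ , λ x∈Y → x∈∁p⇒x∉p (proj₂ (∩⁻ (subst (_ ∈_) (─≡∩∁ X Y) x∈))) x∈Y
      where
      ─≡∩∁ : ∀ {n} (X Y : Subset n) → X ─ Y ≡ X ∩ ∁ Y
      ─≡∩∁ [] [] = refl
      ─≡∩∁ (true ∷ X) (true ∷ Y) = cong (false ∷_) (─≡∩∁ X Y)
      ─≡∩∁ (false ∷ X) (true ∷ Y) = cong (false ∷_) (─≡∩∁ X Y)
      ─≡∩∁ (true ∷ X) (false ∷ Y) = cong (true ∷_) (─≡∩∁ X Y)
      ─≡∩∁ (false ∷ X) (false ∷ Y) = cong (false ∷_) (─≡∩∁ X Y)

  meets⁺ : ∀ {n} {X Y : Subset n} {x} → x ∈ X → x ∈ Y → meetsᵇ X Y ≡ true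
  meets⁺ {X = true ∷ X} {true ∷ Y} {zero} x∈X x∈Y = refl
  meets⁺ {X = a ∷ X} {b ∷ Y} {suc x} (Vec.there x∈X) (Vec.there x∈Y) with a ∧ b
  ... | true  = refl
  ... | false = meets⁺ x∈X x∈Y
  meets⁺ {X = true ∷ X} {false ∷ Y} {zero} x∈X ()
  meets⁺ {X = false ∷ X} {b ∷ Y} {zero} () x∈Y

  meets⁻ : ∀ {n} {X Y : Subset n} → meetsᵇ X Y ≡ true → ∃[ x ] (x ∈ X × x ∈ Y)
  meets⁻ {X = []} {[]} ()
  meets⁻ {X = true ∷ X} {true ∷ Y} e = zero , Vec.here , Vec.here
  meets⁻ {X = true ∷ X} {false ∷ Y} e = let x , p , q = meets⁻ e in suc x , Vec.there p , Vec.there q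
  meets⁻ {X = false ∷ X} {_ ∷ Y} e = let x , p , q = meets⁻ e in suc x , Vec.there p , Vec.there q

  card≡count : ∀ {n} (X : Subset n) → ∣ X ∣ ≡ count (_∈ᵇ X)
  card≡count [] = refl
  card≡count (true ∷ X) = cong suc (card≡count X)
  card≡count (false ∷ X) = card≡count X

  card-insert : ∀ {n} {X : Subset n} {x} → x ∉ X → ∣ X ∪ ⁅ x ⁆ ∣ ≡ suc ∣ X ∣
  card-insert {X = true ∷ X} {zero} x∉ = ⊥-elim (x∉ Vec.here)
  card-insert {X = false ∷ X} {zero} x∉ = cong (suc ∘ ∣_∣) (∪-identityʳ X)
  card-insert {X = true ∷ X} {suc x} x∉ = cong suc (card-insert (x∉ ∘ Vec.there))
  card-insert {X = false ∷ X} {suc x} x∉ = card-insert (x∉ ∘ Vec.there)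

  -- Predecessor closures

  module Closure {n : ℕ} (E : Fin n → Fin n → Set) (E? : ∀ u w → Dec (E u w)) (v : Fin n) where

    private
      Sound : Subset n → Set
      Sound X = v ∈ X × (∀ {u} → u ∈ X → Star E u v)

      -- `k` bounds the number of vertices still to be added. Each round adds one, so
      -- `n ≤ k + ∣ X ∣` persists, and at `k = 0` a further vertex would give more than `n`.
      saturate : ∀ k (X : Subset n) → n ≤ k + ∣ X ∣ → Sound X → ∃[ Y ] (Sound Y × (∀ {u w} → E u w → w ∈ Y → u ∈ Y))
      saturate k X n≤ (v∈ , sound)
        with any? (λ u → any? (λ w → ¬? (u ∈? X) ×-dec (w ∈? X) ×-dec E? u w))
      ... | no none = X , (v∈ , sound) , λ {u} {w} e w∈ →
            decidable-stable (u ∈? X) (λ u∉ → none (u , w , u∉ , w∈ , e))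
      saturate zero X n≤ (v∈ , sound) | yes (u , w , u∉ , w∈ , e) =
        ⊥-elim (1+n≰n (≤-trans (≤-reflexive (sym (card-insert u∉))) (≤-trans (∣p∣≤n (X ∪ ⁅ u ⁆)) n≤)))
      saturate (suc k) X n≤ (v∈ , sound) | yes (u , w , u∉ , w∈ , e) =
        saturate k (X ∪ ⁅ u ⁆)
          (≤-trans n≤ (≤-reflexive (trans (sym (+-suc k _)) (cong (k +_) (sym (card-insert u∉))))))
          (x∈p∪q⁺ (inj₁ v∈) , λ {x} x∈ → [ sound , (λ x∈u → subst (λ y → Star E y v) (sym (x∈⁅y⁆⇒x≡y u x∈u)) (e ◅ sound w∈)) ]′ (∪⁻ x∈))

      result : ∃[ Y ] (Sound Y × (∀ {u w} → E u w → w ∈ Y → u ∈ Y))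
      result = saturate n ⁅ v ⁆ (m≤m+n n _)
        (x∈⁅x⁆ v , λ u∈ → subst (λ y → Star E y v) (sym (x∈⁅y⁆⇒x≡y v u∈)) ε)

    preds : Subset n
    preds = proj₁ result

    preds-sound : ∀ {u} → u ∈ preds → Star E u v
    preds-sound = proj₂ (proj₁ (proj₂ result))

    preds-closed : ∀ {u w} → E u w → w ∈ preds → u ∈ preds
    preds-closed = proj₂ (proj₂ result)

    self∈preds : v ∈ preds
    self∈preds = proj₁ (proj₁ (proj₂ result))

    preds-complete : ∀ {u} → Star E u v → u ∈ preds
    preds-complete ε = self∈preds
    preds-complete (e ◅ p) = preds-closed e (preds-complete p)

  -- Uncrossing of families of bisets

  module _ {n : ℕ} where

    -- A biset (X_O , X_I) of the component C is encoded by X = X_O, with X_I = X ∩ C and wall X ─ C;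
    -- union and intersection of bisets of C are then plain union and intersection.

    enters : Subset n → Fin n → Subset n → Subset n → Bool
    enters t h C X = (h ∈ᵇ (X ∩ C)) ∧ meetsᵇ t (∁ X)

    enters⁻ : ∀ t h C X → enters t h C X ≡ true → h ∈ X × h ∈ C × ∃[ u ] (u ∈ t × u ∉ X)
    enters⁻ t h C X e =
      let p , q = ∧-true⁻ _ _ e
          h∈X , h∈C = ∩⁻ (∈ᵇ⁻ p)
          u , u∈t , u∈∁ = meets⁻ q
      in h∈X , h∈C , u , u∈t , x∈∁p⇒x∉p u∈∁

    enters⁺ : ∀ t {h} C X {u} → h ∈ X → h ∈ C → u ∈ t → u ∉ X → enters t h C X ≡ true
    enters⁺ t C X h∈X h∈C u∈t u∉X = ∧-true⁺ (∈ᵇ⁺ (x∈p∩q⁺ (h∈X , h∈C))) (meets⁺ u∈t (x∉p⇒x∈∁p u∉X))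

    -- A head in the union lies in `X` or in `Y`, and a tail vertex outside the union is outside
    -- both; for the intersection the roles of head and tail are exchanged.
    enters-submod : ∀ t h C X Y →
      𝟙 (enters t h C (X ∪ Y)) + 𝟙 (enters t h C (X ∩ Y)) ≤ 𝟙 (enters t h C X) + 𝟙 (enters t h C Y)
    enters-submod t h C X Y = 𝟙-exchange _ _ _ _ union inter both
      where
      union : enters t h C (X ∪ Y) ≡ true → enters t h C X ≡ true ⊎ enters t h C Y ≡ true
      union e with enters⁻ t h C (X ∪ Y) e
      ... | h∈ , h∈C , u , u∈t , u∉ with ∪⁻ h∈
      ... | inj₁ h∈X = inj₁ (enters⁺ t C X h∈X h∈C u∈t (u∉ ∘ p⊆p∪q Y))
      ... | inj₂ h∈Y = inj₂ (enters⁺ t C Y h∈Y h∈C u∈t (u∉ ∘ q⊆p∪q X Y))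
      inter : enters t h C (X ∩ Y) ≡ true → enters t h C X ≡ true ⊎ enters t h C Y ≡ true
      inter e with enters⁻ t h C (X ∩ Y) e
      ... | h∈ , h∈C , u , u∈t , u∉ with u ∈? X
      ... | no u∉X = inj₁ (enters⁺ t C X (proj₁ (∩⁻ h∈)) h∈C u∈t u∉X)
      ... | yes u∈X = inj₂ (enters⁺ t C Y (proj₂ (∩⁻ {X = X} h∈)) h∈C u∈t (λ u∈Y → u∉ (x∈p∩q⁺ (u∈X , u∈Y))))
      both : enters t h C (X ∪ Y) ≡ true → enters t h C (X ∩ Y) ≡ true →
             enters t h C X ≡ true × enters t h C Y ≡ true
      both e e′ with enters⁻ t h C (X ∪ Y) e | enters⁻ t h C (X ∩ Y) e′
      ... | _ , h∈C , u , u∈t , u∉ | h∈ , _ =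
        enters⁺ t C X (proj₁ (∩⁻ h∈)) h∈C u∈t (u∉ ∘ p⊆p∪q Y) ,
        enters⁺ t C Y (proj₂ (∩⁻ {X = X} h∈)) h∈C u∈t (u∉ ∘ q⊆p∪q X Y)

    _∈⋃_ : Fin n → List (Subset n) → Set
    x ∈⋃ L = ∃[ X ] (X ∈ₗ L × x ∈ X)

    DisjointOn : Subset n → Subset n → Subset n → Set
    DisjointOn C X Y = ∀ {x} → x ∈ C → x ∈ X → x ∉ Y

    disjoint-≡ : ∀ {C L X Y x} → AllPairs (DisjointOn C) L → X ∈ₗ L → Y ∈ₗ L → x ∈ C → x ∈ X → x ∈ Y → X ≡ Y
    disjoint-≡ (d ∷ ds) (here refl) (here refl) x∈C x∈X x∈Y = refl
    disjoint-≡ (d ∷ ds) (here refl) (there Y∈) x∈C x∈X x∈Y = ⊥-elim (All.lookup d Y∈ x∈C x∈X x∈Y)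
    disjoint-≡ (d ∷ ds) (there X∈) (here refl) x∈C x∈X x∈Y = ⊥-elim (All.lookup d X∈ x∈C x∈Y x∈X)
    disjoint-≡ (d ∷ ds) (there X∈) (there Y∈) x∈C x∈X x∈Y = disjoint-≡ ds X∈ Y∈ x∈C x∈X x∈Y

    crosses : Subset n → Subset n → Bool
    crosses f Z = meetsᵇ f Z ∧ meetsᵇ f (∁ Z)

    -- The indicator summed in `eE`, for the family of inner sets `X ∩ C`.
    crossesSome : Subset n → Subset n → List (Subset n) → Bool
    crossesSome f C L = any (λ X → crosses f (X ∩ C)) L

    crossesSome⁻ : ∀ f C L → crossesSome f C L ≡ true →
      ∃[ X ] (X ∈ₗ L × (∃[ x ] (x ∈ f × x ∈ X × x ∈ C)) × (∃[ y ] (y ∈ f × y ∉ X ∩ C)))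
    crossesSome⁻ f C (X ∷ L) e with ∨-true⁻ _ _ e
    ... | inj₁ t =
      let p , q = ∧-true⁻ _ _ t
          x , x∈f , x∈ = meets⁻ p
          y , y∈f , y∈ = meets⁻ q
      in X , here refl , (x , x∈f , ∩⁻ x∈) , (y , y∈f , x∈∁p⇒x∉p y∈)
    ... | inj₂ t = let Z , Z∈ , r = crossesSome⁻ f C L t in Z , there Z∈ , r

    crossesSome⁺ : ∀ f C L {X x y} → X ∈ₗ L → x ∈ f → x ∈ X → x ∈ C → y ∈ f → y ∉ X ∩ C →
      crossesSome f C L ≡ true
    crossesSome⁺ f C (X ∷ L) (here refl) x∈f x∈X x∈C y∈f y∉
      rewrite ∧-true⁺ (meets⁺ x∈f (x∈p∩q⁺ (x∈X , x∈C))) (meets⁺ y∈f (x∉p⇒x∈∁p y∉)) = refl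
    crossesSome⁺ f C (Z ∷ L) (there X∈) x∈f x∈X x∈C y∈f y∉ with crosses f (Z ∩ C)
    ... | true  = refl
    ... | false = crossesSome⁺ f C L X∈ x∈f x∈X x∈C y∈f y∉

    crossesSome-false : ∀ f C L {X x y} → crossesSome f C L ≡ false →
      X ∈ₗ L → x ∈ f → x ∈ X → x ∈ C → y ∈ f → y ∈ X ∩ C
    crossesSome-false f C L {X} {y = y} e X∈ x∈f x∈X x∈C y∈f =
      decidable-stable (y ∈? (X ∩ C)) λ y∉ → true≢false (crossesSome⁺ f C L X∈ x∈f x∈X x∈C y∈f y∉) e

  module Uncrossing {n : ℕ} (C : Subset n) (A : Subset n → Set)
    (A-∪ : ∀ {X Y x} → A X → A Y → x ∈ X → x ∈ Y → x ∈ C → A (X ∪ Y))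
    (A-∩ : ∀ {X Y x} → A X → A Y → x ∈ X → x ∈ Y → x ∈ C → A (X ∩ Y))
    (b : Subset n → ℕ)
    (b-submod : ∀ X Y → b (X ∪ Y) + b (X ∩ Y) ≤ b X + b Y) where

    Σb : List (Subset n) → ℕ
    Σb L = sum (map b L)

    Σb-++ : ∀ L L′ → Σb (L ++ L′) ≡ Σb L + Σb L′
    Σb-++ L L′ = trans (cong sum (map-++ b L L′)) (sum-++ (map b L) (map b L′))

    Family : List (Subset n) → Set
    Family L = All A L × AllPairs (DisjointOn C) L

    -- `outer` is `L` with `X` merged into the members it meets on `C`; `inner` collects the
    -- overlaps cut off on the way. An overlap is cut from the already enlarged set, so its upper
    -- bound is stated inside `C` only.
    record Insertion (X : Subset n) (L : List (Subset n)) : Set where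
      field
        outer inner : List (Subset n)
        outer-family : Family outer
        inner-family : Family inner
        outer-⊆ : ∀ {x} → x ∈⋃ outer → x ∈ X ⊎ x ∈⋃ L
        outer-⊇X : ∃[ Z ] (Z ∈ₗ outer × X ⊆ Z)
        outer-⊇L : ∀ {Y} → Y ∈ₗ L → ∃[ Z ] (Z ∈ₗ outer × Y ⊆ Z)
        inner-⊆ : ∀ {x} → x ∈ C → x ∈⋃ inner → x ∈ X × x ∈⋃ L
        inner-⊇ : ∀ {Y x} → Y ∈ₗ L → x ∈ X → x ∈ Y → x ∈ C → ∃[ Z ] (Z ∈ₗ inner × X ∩ Y ⊆ Z)
        lengths : length outer + length inner ≡ suc (length L)
        weights : Σb outer + Σb inner ≤ b X + Σb L

    insert : ∀ X L → A X → Family L → Insertion X L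
    insert X [] aX _ = record
      { outer = X ∷ [] ; inner = []
      ; outer-family = (aX ∷ []) , ([] ∷ []) ; inner-family = [] , []
      ; outer-⊆ = λ { (Z , here refl , x∈) → inj₁ x∈ }
      ; outer-⊇X = X , here refl , λ x∈ → x∈
      ; outer-⊇L = λ ()
      ; inner-⊆ = λ { _ (_ , () , _) }
      ; inner-⊇ = λ ()
      ; lengths = refl
      ; weights = ≤-reflexive (+-identityʳ _) }
    insert X (Y ∷ L) aX (aY ∷ aL , dY ∷ dL) with any? (λ x → (x ∈? X) ×-dec (x ∈? Y) ×-dec (x ∈? C))
    ... | yes (z , z∈X , z∈Y , z∈C) = record
      { outer = outer ; inner = (X ∩ Y) ∷ inner
      ; outer-family = outer-family
      ; inner-family = (A-∩ aX aY z∈X z∈Y z∈C ∷ proj₁ inner-family)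
                     , (All.tabulate (λ Z∈ x∈C x∈ x∈Z → avoidsY x∈C (_ , Z∈ , x∈Z) (proj₂ (∩⁻ {X = X} x∈)))
                        ∷ proj₂ inner-family)
      ; outer-⊆ = λ x∈ → [ (λ x∈∪ → [ inj₁ , (λ x∈Y → inj₂ (Y , here refl , x∈Y)) ]′ (∪⁻ x∈∪))
                         , (λ { (Z , Z∈ , x∈Z) → inj₂ (Z , there Z∈ , x∈Z) }) ]′ (outer-⊆ x∈)
      ; outer-⊇X = let Z , Z∈ , s = outer-⊇X in Z , Z∈ , s ∘ p⊆p∪q Y
      ; outer-⊇L = λ { (here refl) → let Z , Z∈ , s = outer-⊇X in Z , Z∈ , s ∘ q⊆p∪q X Y
                     ; (there Y∈) → outer-⊇L Y∈ }
      ; inner-⊆ = inner-in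
      ; inner-⊇ = λ { (here refl) _ _ _ → X ∩ Y , here refl , λ x∈ → x∈
                    ; {Y′} (there Y∈) x∈X x∈Y x∈C →
                        let Z , Z∈ , s = inner-⊇ Y∈ (p⊆p∪q Y x∈X) x∈Y x∈C
                        in Z , there Z∈ , λ x∈ → s (x∈p∩q⁺ (p⊆p∪q Y (proj₁ (∩⁻ x∈)) , proj₂ (∩⁻ {X = X} {Y = Y′} x∈))) }
      ; lengths = trans (+-suc _ _) (cong suc lengths)
      ; weights = begin
          Σb outer + (b (X ∩ Y) + Σb inner) ≡⟨ rearrange (Σb outer) (b (X ∩ Y)) (Σb inner) ⟩
          (Σb outer + Σb inner) + b (X ∩ Y) ≤⟨ +-monoˡ-≤ _ weights ⟩
          (b (X ∪ Y) + Σb L) + b (X ∩ Y)    ≡⟨ rearrange′ (b (X ∪ Y)) (Σb L) (b (X ∩ Y)) ⟩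
          (b (X ∪ Y) + b (X ∩ Y)) + Σb L    ≤⟨ +-monoˡ-≤ _ (b-submod X Y) ⟩
          (b X + b Y) + Σb L                ≡⟨ +-assoc (b X) (b Y) (Σb L) ⟩
          b X + (b Y + Σb L)                ∎ }
      where
      open ≤-Reasoning
      open Insertion (insert (X ∪ Y) L (A-∪ aX aY z∈X z∈Y z∈C) (aL , dL))
      rearrange : ∀ p q r → p + (q + r) ≡ (p + r) + q
      rearrange = solve-∀
      rearrange′ : ∀ p q r → (p + q) + r ≡ (p + r) + q
      rearrange′ = solve-∀
      avoidsY : ∀ {x} → x ∈ C → x ∈⋃ inner → x ∉ Y
      avoidsY x∈C x∈ x∈Y with inner-⊆ x∈C x∈
      ... | _ , (Y′ , Y′∈ , x∈Y′) = All.lookup dY Y′∈ x∈C x∈Y x∈Y′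
      -- The recursive call cuts overlaps from `X ∪ Y`, but these also lie in later members, which
      -- are disjoint from `Y` on `C`; so they come from `X`.
      inner-in : ∀ {x} → x ∈ C → x ∈⋃ ((X ∩ Y) ∷ inner) → x ∈ X × x ∈⋃ (Y ∷ L)
      inner-in x∈C (_ , here refl , x∈) = proj₁ (∩⁻ x∈) , (Y , here refl , proj₂ (∩⁻ {X = X} x∈))
      inner-in x∈C (Z , there Z∈ , x∈) with inner-⊆ x∈C (Z , Z∈ , x∈)
      ... | x∈∪ , (Y′ , Y′∈ , x∈Y′) with ∪⁻ x∈∪
      ... | inj₁ x∈X = x∈X , (Y′ , there Y′∈ , x∈Y′)
      ... | inj₂ x∈Y = ⊥-elim (avoidsY x∈C (Z , Z∈ , x∈) x∈Y)
    ... | no disj = record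
      { outer = Y ∷ outer ; inner = inner
      ; outer-family = (aY ∷ proj₁ outer-family)
                     , (All.tabulate (λ Z∈ → avoidsY Z∈) ∷ proj₂ outer-family)
      ; inner-family = inner-family
      ; outer-⊆ = λ { (_ , here refl , x∈) → inj₂ (Y , here refl , x∈)
                    ; (Z , there Z∈ , x∈) → [ inj₁ , (λ { (Y′ , Y′∈ , x∈Y′) → inj₂ (Y′ , there Y′∈ , x∈Y′) }) ]′
                                              (outer-⊆ (Z , Z∈ , x∈)) }
      ; outer-⊇X = let Z , Z∈ , s = outer-⊇X in Z , there Z∈ , s
      ; outer-⊇L = λ { (here refl) → Y , here refl , λ x∈ → x∈
                     ; (there Y∈) → let Z , Z∈ , s = outer-⊇L Y∈ in Z , there Z∈ , s }
      ; inner-⊆ = λ x∈C x∈ → let x∈X , (Y′ , Y′∈ , x∈Y′) = inner-⊆ x∈C x∈ in x∈X , (Y′ , there Y′∈ , x∈Y′)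
      ; inner-⊇ = λ { (here refl) x∈X x∈Y x∈C → ⊥-elim (disj (_ , x∈X , x∈Y , x∈C))
                    ; (there Y∈) → inner-⊇ Y∈ }
      ; lengths = cong suc lengths
      ; weights = begin
          (b Y + Σb outer) + Σb inner ≡⟨ +-assoc (b Y) _ _ ⟩
          b Y + (Σb outer + Σb inner) ≤⟨ +-monoʳ-≤ (b Y) weights ⟩
          b Y + (b X + Σb L)          ≡⟨ rearrange (b Y) (b X) (Σb L) ⟩
          b X + (b Y + Σb L)          ∎ }
      where
      open ≤-Reasoning
      open Insertion (insert X L aX (aL , dL))
      rearrange : ∀ p q r → p + (q + r) ≡ q + (p + r)
      rearrange = solve-∀
      avoidsY : ∀ {Z} → Z ∈ₗ outer → DisjointOn C Y Z
      avoidsY Z∈ x∈C x∈Y x∈Z with outer-⊆ (_ , Z∈ , x∈Z)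
      ... | inj₁ x∈X = disj (_ , x∈X , x∈Y , x∈C)
      ... | inj₂ (Y′ , Y′∈ , x∈Y′) = All.lookup dY Y′∈ x∈C x∈Y x∈Y′

    -- The analogue for families of union and intersection: under it `length` is modular and `Σb`
    -- submodular.
    record Lattice (P Q : List (Subset n)) : Set where
      field
        join meet : List (Subset n)
        join-family : Family join
        meet-family : Family meet
        join-⊆ : ∀ {x} → x ∈⋃ join → x ∈⋃ P ⊎ x ∈⋃ Q
        join-⊇P : ∀ {X} → X ∈ₗ P → ∃[ Z ] (Z ∈ₗ join × X ⊆ Z)
        join-⊇Q : ∀ {X} → X ∈ₗ Q → ∃[ Z ] (Z ∈ₗ join × X ⊆ Z)
        meet-⊆ : ∀ {x} → x ∈ C → x ∈⋃ meet → x ∈⋃ P × x ∈⋃ Q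
        meet-⊇ : ∀ {X Y x} → X ∈ₗ P → Y ∈ₗ Q → x ∈ X → x ∈ Y → x ∈ C → ∃[ Z ] (Z ∈ₗ meet × X ∩ Y ⊆ Z)
        lengths : length join + length meet ≡ length P + length Q
        weights : Σb join + Σb meet ≤ Σb P + Σb Q

    -- Repeatedly replacing an intersecting pair X, Y by X ∪ Y and X ∩ Y, one member of P at a time.
    lattice : ∀ P Q → Family P → Family Q → Lattice P Q
    lattice [] Q _ fQ = record
      { join = Q ; meet = []
      ; join-family = fQ ; meet-family = [] , []
      ; join-⊆ = inj₂ ; join-⊇P = λ () ; join-⊇Q = λ {X} X∈ → X , X∈ , λ x∈ → x∈
      ; meet-⊆ = λ { _ (_ , () , _) } ; meet-⊇ = λ ()
      ; lengths = +-identityʳ _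
      ; weights = ≤-reflexive (+-identityʳ _) }
    lattice (X ∷ P) Q (aX ∷ aP , dX ∷ dP) fQ = record
      { join = outer ; meet = inner ++ meet
      ; join-family = outer-family
      ; meet-family = All.++⁺ (proj₁ inner-family) (proj₁ meet-family)
                    , AllPairs.++⁺ (proj₂ inner-family) (proj₂ meet-family)
                        (All.tabulate λ Z∈ → All.tabulate λ Z′∈ x∈C x∈Z x∈Z′ →
                          avoidsX x∈C (proj₁ (inner-⊆ x∈C (_ , Z∈ , x∈Z))) (proj₁ (meet-⊆ x∈C (_ , Z′∈ , x∈Z′))))
      ; join-⊆ = λ x∈ → [ (λ x∈X → inj₁ (X , here refl , x∈X))
                        , (λ x∈J → [ (λ { (Z , Z∈ , x∈Z) → inj₁ (Z , there Z∈ , x∈Z) }) , inj₂ ]′ (join-⊆ x∈J)) ]′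
                        (outer-⊆ x∈)
      ; join-⊇P = λ { (here refl) → outer-⊇X
                    ; (there X∈) → lift (join-⊇P X∈) }
      ; join-⊇Q = λ X∈ → lift (join-⊇Q X∈)
      ; meet-⊆ = λ { x∈C (Z , Z∈ , x∈Z) → [ (λ Z∈i → fromInner x∈C (Z , Z∈i , x∈Z))
                                          , (λ Z∈m → fromMeet (meet-⊆ x∈C (Z , Z∈m , x∈Z))) ]′ (∈-++⁻ inner Z∈) }
      ; meet-⊇ = covers
      ; lengths = trans (cong (length outer +_) (length-++ inner))
          (trans (sym (+-assoc (length outer) _ _))
          (trans (cong (_+ length meet) I.lengths) (cong suc J.lengths)))
      ; weights = begin
          Σb outer + Σb (inner ++ meet)     ≡⟨ cong (Σb outer +_) (Σb-++ inner meet) ⟩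
          Σb outer + (Σb inner + Σb meet)   ≡⟨ +-assoc (Σb outer) _ _ ⟨
          (Σb outer + Σb inner) + Σb meet   ≤⟨ +-monoˡ-≤ _ I.weights ⟩
          (b X + Σb join) + Σb meet         ≡⟨ +-assoc (b X) _ _ ⟩
          b X + (Σb join + Σb meet)         ≤⟨ +-monoʳ-≤ (b X) J.weights ⟩
          b X + (Σb P + Σb Q)               ≡⟨ +-assoc (b X) _ _ ⟨
          (b X + Σb P) + Σb Q               ∎ }
      where
      open ≤-Reasoning
      module J = Lattice (lattice P Q (aP , dP) fQ)
      open J using (join; meet; join-family; meet-family; join-⊆; join-⊇P; join-⊇Q; meet-⊆; meet-⊇)
      module I = Insertion (insert X join aX join-family)
      open I using (outer; inner; outer-family; inner-family; outer-⊆; outer-⊇X; outer-⊇L; inner-⊆; inner-⊇)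
      avoidsX : ∀ {x} → x ∈ C → x ∈ X → ¬ (x ∈⋃ P)
      avoidsX x∈C x∈X (Z , Z∈ , x∈Z) = All.lookup dX Z∈ x∈C x∈X x∈Z
      lift : ∀ {Y : Subset n} → ∃[ Z ] (Z ∈ₗ join × Y ⊆ Z) → ∃[ Z ] (Z ∈ₗ outer × Y ⊆ Z)
      lift (Z , Z∈ , s) = let Z′ , Z′∈ , s′ = outer-⊇L Z∈ in Z′ , Z′∈ , s′ ∘ s
      fromInner : ∀ {x} → x ∈ C → x ∈⋃ inner → x ∈⋃ (X ∷ P) × x ∈⋃ Q
      fromInner x∈C x∈ with inner-⊆ x∈C x∈
      ... | x∈X , x∈J with join-⊆ x∈J
      ... | inj₁ x∈P = ⊥-elim (avoidsX x∈C x∈X x∈P)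
      ... | inj₂ x∈Q = (X , here refl , x∈X) , x∈Q
      fromMeet : ∀ {x} → x ∈⋃ P × x ∈⋃ Q → x ∈⋃ (X ∷ P) × x ∈⋃ Q
      fromMeet ((Z , Z∈ , x∈Z) , x∈Q) = (Z , there Z∈ , x∈Z) , x∈Q
      covers : ∀ {X′ Y x} → X′ ∈ₗ (X ∷ P) → Y ∈ₗ Q → x ∈ X′ → x ∈ Y → x ∈ C →
        ∃[ Z ] (Z ∈ₗ (inner ++ meet) × X′ ∩ Y ⊆ Z)
      covers {Y = Y} (here refl) Y∈ x∈X x∈Y x∈C with join-⊇Q Y∈
      ... | Y′ , Y′∈ , s with inner-⊇ Y′∈ x∈X (s x∈Y) x∈C
      ... | Z , Z∈ , s′ = Z , ∈-++⁺ˡ Z∈ , λ x∈ → s′ (x∈p∩q⁺ (proj₁ (∩⁻ x∈) , s (proj₂ (∩⁻ {X = X} {Y = Y} x∈))))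
      covers (there X∈) Y∈ x∈X x∈Y x∈C with meet-⊇ X∈ Y∈ x∈X x∈Y x∈C
      ... | Z , Z∈ , s = Z , ∈-++⁺ʳ inner Z∈ , s

    -- A hyperedge that touches a family on `C` without crossing it lies inside one member. The join
    -- contains the old members and the meet their overlaps, so containment carries over to both.
    crossesSome-exchange : ∀ {P Q} (fP : Family P) (fQ : Family Q) (f : Subset n) →
      let open Lattice (lattice P Q fP fQ) in
      𝟙 (crossesSome f C join) + 𝟙 (crossesSome f C meet) ≤ 𝟙 (crossesSome f C P) + 𝟙 (crossesSome f C Q)
    crossesSome-exchange {P} {Q} fP fQ f = 𝟙-exchange _ _ _ _ caseJ caseM both
      where
      open Lattice (lattice P Q fP fQ)

      -- By disjointness the member of `join` containing `x` is the one above `W`, and `W` already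
      -- contains `f`.
      joinAbsorbs : ∀ {W x} → (∃[ Z ] (Z ∈ₗ join × W ⊆ Z)) → x ∈ W → x ∈ C → (∀ {y} → y ∈ f → y ∈ W ∩ C) →
        ∀ {X} → X ∈ₗ join → x ∈ X → ∀ {y} → y ∈ f → y ∈ X ∩ C
      joinAbsorbs (Z , Z∈ , s) x∈W x∈C sub X∈ x∈X y∈f
        rewrite disjoint-≡ (proj₂ join-family) X∈ Z∈ x∈C x∈X (s x∈W) =
        x∈p∩q⁺ (s (proj₁ (∩⁻ (sub y∈f))) , proj₂ (∩⁻ (sub y∈f)))

      caseJ : crossesSome f C join ≡ true → crossesSome f C P ≡ true ⊎ crossesSome f C Q ≡ true
      caseJ e with true-or-false (crossesSome f C P) | true-or-false (crossesSome f C Q)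
      ... | inj₁ t | _ = inj₁ t
      ... | inj₂ _ | inj₁ t = inj₂ t
      ... | inj₂ p | inj₂ q with crossesSome⁻ f C join e
      ... | X , X∈ , (x , x∈f , x∈X , x∈C) , (y , y∈f , y∉) with join-⊆ (X , X∈ , x∈X)
      ... | inj₁ (W , W∈ , x∈W) = ⊥-elim (y∉ (joinAbsorbs (join-⊇P W∈) x∈W x∈C
              (crossesSome-false f C P p W∈ x∈f x∈W x∈C) X∈ x∈X y∈f))
      ... | inj₂ (W , W∈ , x∈W) = ⊥-elim (y∉ (joinAbsorbs (join-⊇Q W∈) x∈W x∈C
              (crossesSome-false f C Q q W∈ x∈f x∈W x∈C) X∈ x∈X y∈f))

      caseM : crossesSome f C meet ≡ true → crossesSome f C P ≡ true ⊎ crossesSome f C Q ≡ true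
      caseM e with true-or-false (crossesSome f C P) | true-or-false (crossesSome f C Q)
      ... | inj₁ t | _ = inj₁ t
      ... | inj₂ _ | inj₁ t = inj₂ t
      ... | inj₂ p | inj₂ q with crossesSome⁻ f C meet e
      ... | Z , Z∈ , (z , z∈f , z∈Z , z∈C) , (y , y∈f , y∉) with meet-⊆ z∈C (Z , Z∈ , z∈Z)
      ... | (X , X∈ , z∈X) , (Y , Y∈ , z∈Y) with meet-⊇ X∈ Y∈ z∈X z∈Y z∈C
      ... | Z′ , Z′∈ , s rewrite disjoint-≡ (proj₂ meet-family) Z∈ Z′∈ z∈C z∈Z (s (x∈p∩q⁺ (z∈X , z∈Y))) =
        let y∈X , y∈C = ∩⁻ (crossesSome-false f C P p X∈ z∈f z∈X z∈C y∈f)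
            y∈Y , _   = ∩⁻ (crossesSome-false f C Q q Y∈ z∈f z∈Y z∈C y∈f)
        in ⊥-elim (y∉ (x∈p∩q⁺ (s (x∈p∩q⁺ (y∈X , y∈Y)) , y∈C)))

      -- A member of the meet touching f lies in ⋃P and ⋃Q; if P does not cross f then f is inside one
      -- member of P, hence inside one member of the join.
      both : crossesSome f C join ≡ true → crossesSome f C meet ≡ true →
             crossesSome f C P ≡ true × crossesSome f C Q ≡ true
      both eJ eM with crossesSome⁻ f C join eJ | crossesSome⁻ f C meet eM
      ... | X , X∈ , (x , x∈f , x∈X , x∈C) , (y , y∈f , y∉) | Z , Z∈ , (z , z∈f , z∈Z , z∈C) , _
        with meet-⊆ z∈C (Z , Z∈ , z∈Z)
      ... | (W , W∈ , z∈W) , (W′ , W′∈ , z∈W′) =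
        [ (λ t → t) , (λ p → ⊥-elim (absurd {P} W∈ z∈W (join-⊇P W∈) p)) ]′ (true-or-false (crossesSome f C P)) ,
        [ (λ t → t) , (λ q → ⊥-elim (absurd {Q} W′∈ z∈W′ (join-⊇Q W′∈) q)) ]′ (true-or-false (crossesSome f C Q))
        where
        absurd : ∀ {L V} → V ∈ₗ L → z ∈ V → (∃[ Z ] (Z ∈ₗ join × V ⊆ Z)) → crossesSome f C L ≡ false →
          Empty.⊥
        absurd {L} V∈ z∈V above e =
          let sub = λ {y} → crossesSome-false f C L {y = y} e V∈ z∈f z∈V z∈C
          in y∉ (joinAbsorbs above (proj₁ (∩⁻ (sub x∈f))) x∈C sub X∈ x∈X y∈f)

  -- Strongly connected components and admissible bisets.

  module Components {n : ℕ} (E : Fin n → Fin n → Set) (E? : ∀ u w → Dec (E u w))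
    (R : Subset n) (ρ : Subset n → ℕ) where

    P : Fin n → Subset n
    P v = Closure.preds E E? v

    P⁺ : ∀ {u v} → Star E u v → u ∈ P v
    P⁺ {v = v} = Closure.preds-complete E E? v

    P⁻ : ∀ {u v} → u ∈ P v → Star E u v
    P⁻ {v = v} = Closure.preds-sound E E? v

    private
      C? : ∀ v w → Dec (w ∈ P v × v ∈ P w)
      C? v w = (w ∈? P v) ×-dec (v ∈? P w)

    C : Fin n → Subset n
    C v = comprehension (C? v)

    C⁺ : ∀ {v w} → Star E w v → Star E v w → w ∈ C v
    C⁺ {v} p q = ∈-comprehension⁺ (C? v) (P⁺ p , P⁺ q)

    C⁻ : ∀ {v w} → w ∈ C v → Star E w v × Star E v w
    C⁻ {v} w∈ = let p , q = ∈-comprehension⁻ (C? v) w∈ in P⁻ p , P⁻ q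

    v∈Cv : ∀ v → v ∈ C v
    v∈Cv v = C⁺ ε ε

    C-≡ : ∀ {v w} → w ∈ C v → C w ≡ C v
    C-≡ w∈ = let p , q = C⁻ w∈ in ⊆-antisym
      (λ x∈ → let a , b = C⁻ x∈ in C⁺ (a ◅◅ p) (q ◅◅ b))
      (λ x∈ → let a , b = C⁻ x∈ in C⁺ (a ◅◅ q) (p ◅◅ b))

    P-⊆ : ∀ {v w} → Star E w v → P w ⊆ P v
    P-⊆ p x∈ = P⁺ (P⁻ x∈ ◅◅ p)

    P-≡ : ∀ {v w} → w ∈ C v → P w ≡ P v
    P-≡ w∈ = let p , q = C⁻ w∈ in ⊆-antisym (P-⊆ p) (P-⊆ q)

    -- The biset conditions, encoded by the outer set: first, the inner set is nonempty; second, the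
    -- wall is closed under predecessors, expressed one step at a time.
    Admissible : Subset n → Subset n → Set
    Admissible D X = (∃[ x ] (x ∈ X × x ∈ D)) × (∀ u w → E u w → w ∈ X → w ∉ D → u ∈ X × u ∉ D)

    admissible? : ∀ D X → Dec (Admissible D X)
    admissible? D X = any? (λ x → (x ∈? X) ×-dec (x ∈? D)) ×-dec
      all? (λ u → all? (λ w → E? u w →-dec (w ∈? X) →-dec ¬? (w ∈? D) →-dec ((u ∈? X) ×-dec ¬? (u ∈? D))))

    admissible-∪ : ∀ {D X Y x} → Admissible D X → Admissible D Y → x ∈ X → x ∈ Y → x ∈ D → Admissible D (X ∪ Y)
    admissible-∪ {X = X} {Y} {x} (_ , cX) (_ , cY) x∈X _ x∈D = (x , p⊆p∪q Y x∈X , x∈D) , λ u w e w∈ w∉ →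
      [ (λ w∈X → let p , q = cX u w e w∈X w∉ in p⊆p∪q Y p , q)
      , (λ w∈Y → let p , q = cY u w e w∈Y w∉ in q⊆p∪q X Y p , q) ]′ (∪⁻ w∈)

    admissible-∩ : ∀ {D X Y x} → Admissible D X → Admissible D Y → x ∈ X → x ∈ Y → x ∈ D → Admissible D (X ∩ Y)
    admissible-∩ {X = X} {Y} {x} (_ , cX) (_ , cY) x∈X x∈Y x∈D = (x , x∈p∩q⁺ (x∈X , x∈Y) , x∈D) , λ u w e w∈ w∉ →
      let p , q = cX u w e (proj₁ (∩⁻ w∈)) w∉ in
      x∈p∩q⁺ (p , proj₁ (cY u w e (proj₂ (∩⁻ {X = X} w∈)) w∉)) , q

    k : Fin n → ℕ
    k v = ρ (P v)

  -- Orientation of the hyperedges.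

  module Orientation {n : ℕ} (E : Fin n → Fin n → Set) (E? : ∀ u w → Dec (E u w))
    (R : Subset n) (ρ : Subset n → ℕ) where

    open Components E E? R ρ

    Weight : Set
    Weight = Subset n → Subset n → ℕ

    Submodular : Weight → Set
    Submodular b = ∀ D X Y → b D (X ∪ Y) + b D (X ∩ Y) ≤ b D X + b D Y

    -- The condition of the theorem in additive form: `b` is meant to carry both the in-degree and
    -- the rank of the wall, so that nothing is subtracted.
    Covered : ∀ {m} → (Fin m → Subset n) → Weight → Set
    Covered he b = ∀ v → v ∉ R → ∀ L → All (Admissible (C v)) L → AllPairs (DisjointOn (C v)) L →
      length L * k v ≤ count (λ i → crossesSome (he i) (C v) L) + sum (map (b (C v)) L)

    InComponent : Subset n → Set
    InComponent f = ∃[ x ] (x ∈ f × x ∉ R × f ⊆ C x)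

    -- Counts `f` as a dyperedge with head `w` whose tail is all of `f`. Keeping `w` in the tail is
    -- harmless, since `w` lies in every set that is entered.
    _⊕_⟶_ : Weight → Subset n → Fin n → Weight
    (b ⊕ f ⟶ w) D X = b D X + 𝟙 (enters f w D X)

    submodular-⊕ : ∀ {b} f w → Submodular b → Submodular (b ⊕ f ⟶ w)
    submodular-⊕ {b} f w sb D X Y =
      +-exchange-≤ {b D (X ∪ Y)} {b D (X ∩ Y)} {b D X} {b D Y} (sb D X Y) (enters-submod f w D X Y)

    sum-⊕ : ∀ b f w D L → sum (map ((b ⊕ f ⟶ w) D) L) ≡ sum (map (b D) L) + sum (map (λ X → 𝟙 (enters f w D X)) L)
    sum-⊕ b f w D L = sum-map-+ (b D) (λ X → 𝟙 (enters f w D X)) L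

    sum-member : ∀ (g : Subset n → ℕ) {X L} → X ∈ₗ L → g X ≤ sum (map g L)
    sum-member g (here refl) = m≤m+n _ _
    sum-member g (there X∈) = ≤-trans (sum-member g X∈) (m≤n+m _ _)

    module Trim {m : ℕ} (he : Fin (suc m) → Subset n) (b : Weight) (b-submod : Submodular b)
      (covered : Covered he b) (e-comp : InComponent (he zero)) where

      private
        e : Subset n
        e = he zero
        x₀ : Fin n
        x₀ = proj₁ e-comp
        D : Subset n
        D = C x₀
        κ : ℕ
        κ = k x₀
        e⊆D : e ⊆ D
        e⊆D = proj₂ (proj₂ (proj₂ e-comp))
        open Uncrossing D (Admissible D) admissible-∪ admissible-∩ (b D) (b-submod D)

        crossed value : List (Subset n) → ℕ
        crossed L = count (λ i → crossesSome (he (suc i)) D L)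
        value L = crossed L + Σb L

        covered-D : ∀ L → Family L → length L * κ ≤ 𝟙 (crossesSome e D L) + value L
        covered-D L (aL , dL) = ≤-trans (covered x₀ (proj₁ (proj₂ (proj₂ e-comp))) L aL dL)
          (≤-reflexive (+-assoc (𝟙 (crossesSome e D L)) _ _))

        covered-suc : ∀ L → Family L → length L * κ ≤ suc (value L)
        covered-suc L fL = ≤-trans (covered-D L fL) (+-monoˡ-≤ _ (𝟙≤1 (crossesSome e D L)))

        -- The condition fails once `e` is deleted; by `covered-suc` it then fails by exactly one.
        Deficient : List (Subset n) → Set
        Deficient L = Family L × value L < length L * κ

        deficient-crossed : ∀ {L} → Deficient L → crossesSome e D L ≡ true
        deficient-crossed {L} (fL , d) with true-or-false (crossesSome e D L)
        ... | inj₁ t = t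
        ... | inj₂ f with covered-D L fL
        ... | p rewrite f = ⊥-elim (<⇒≱ d p)

        value-exchange : ∀ {P Q} (fP : Family P) (fQ : Family Q) → let open Lattice (lattice P Q fP fQ) in
          value join + value meet ≤ value P + value Q
        value-exchange {P} {Q} fP fQ = +-exchange-≤ {crossed L.join} {crossed L.meet} {crossed P} {crossed Q}
          (count-exchange {p = λ i → crossesSome (he (suc i)) D L.join} {λ i → crossesSome (he (suc i)) D L.meet}
            {λ i → crossesSome (he (suc i)) D P} {λ i → crossesSome (he (suc i)) D Q}
            (λ i → crossesSome-exchange fP fQ (he (suc i)))) L.weights
          where module L = Lattice (lattice P Q fP fQ)

        -- Lengths are preserved and values do not increase, so join and meet together fall short by
        -- at least two; `covered-suc` allows the join to account for only one.
        deficient-meet : ∀ {P Q} (dP : Deficient P) (dQ : Deficient Q) →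
          Deficient (Lattice.meet (lattice P Q (proj₁ dP) (proj₁ dQ)))
        deficient-meet {P} {Q} (fP , dP) (fQ , dQ) = meet-family , +-cancelˡ-≤ (suc (value join)) _ _ (begin
          suc (value join) + suc (value meet)       ≡⟨ shift (value join) (value meet) ⟩
          2 + (value join + value meet)             ≤⟨ +-monoʳ-≤ 2 (value-exchange fP fQ) ⟩
          2 + (value P + value Q)                   ≡⟨ shift (value P) (value Q) ⟨
          suc (value P) + suc (value Q)             ≤⟨ +-mono-≤ dP dQ ⟩
          length P * κ + length Q * κ               ≡⟨ *-distribʳ-+ κ (length P) (length Q) ⟨
          (length P + length Q) * κ                 ≡⟨ cong (_* κ) lengths ⟨
          (length join + length meet) * κ           ≡⟨ *-distribʳ-+ κ (length join) (length meet) ⟩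
          length join * κ + length meet * κ         ≤⟨ +-monoˡ-≤ _ (covered-suc join join-family) ⟩
          suc (value join) + length meet * κ        ∎)
          where
          open ≤-Reasoning
          open Lattice (lattice P Q fP fQ)
          shift : ∀ p q → suc p + suc q ≡ 2 + (p + q)
          shift = solve-∀

        ∈⋃? : ∀ L (x : Fin n) → Dec (x ∈⋃ L)
        ∈⋃? L x = map′ find (λ { (X , X∈ , x∈X) → lose X∈ x∈X })
                       (Any.any? (x ∈?_) L)

        trace? : ∀ L (x : Fin n) → Dec (x ∈ e × x ∈⋃ L)
        trace? L x = (x ∈? e) ×-dec ∈⋃? L x

        -- Its size is the measure of the descent in `legal-head`.
        trace : List (Subset n) → Subset n
        trace L = comprehension (trace? L)

      Covered-after : Fin n → Set
      Covered-after w = Covered (he ∘ suc) (b ⊕ e ⟶ w)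

      private
        -- If every deficient family contains w then w is a legal head: a family deficient after the
        -- orientation is crossed by e, yet not entered by the new dyperedge, hence avoids w.
        legal : ∀ w → w ∈ e → (∀ L → Deficient L → ¬ (w ∈⋃ L) → Empty.⊥) → Covered-after w
        legal w w∈e none v v∉R L aL dL with x₀ ∈? C v
        -- In another component: `e` lies in `D`, so it crosses no family of `C v`, and the added
        -- term only helps.
        ... | no x₀∉ = begin
              length L * k v ≤⟨ covered v v∉R L aL dL ⟩
              (𝟙 (crossesSome e (C v) L) + cr) + s ≡⟨ cong (λ z → (𝟙 z + cr) + s) uncrossed ⟩
              cr + s ≤⟨ +-monoʳ-≤ cr (m≤m+n s _) ⟩
              cr + (s + _) ≡⟨ cong (cr +_) (sum-⊕ b e w (C v) L) ⟨
              cr + sum (map ((b ⊕ e ⟶ w) (C v)) L) ∎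
          where
          open ≤-Reasoning
          cr s : ℕ
          cr = count (λ i → crossesSome (he (suc i)) (C v) L)
          s = sum (map (b (C v)) L)
          uncrossed : crossesSome e (C v) L ≡ false
          uncrossed with true-or-false (crossesSome e (C v) L)
          ... | inj₂ f = f
          ... | inj₁ t with crossesSome⁻ e (C v) L t
          ... | _ , _ , (x , x∈e , _ , x∈C) , _ =
            ⊥-elim (x₀∉ (subst (x₀ ∈_) (trans (sym (C-≡ (e⊆D x∈e))) (C-≡ x∈C)) (v∈Cv x₀)))
        ... | yes x₀∈ rewrite sym (C-≡ x₀∈) | sym (P-≡ x₀∈) | sum-⊕ b e w D L =
          decidable-stable (_ ≤? _) λ ≰ →
            let new = sum (map (λ X → 𝟙 (enters e w D X)) L)
                lt : value L + new < length L * κ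
                lt = subst (_< length L * κ) (sym (+-assoc (crossed L) (Σb L) new)) (≰⇒> ≰)
                def : Deficient L
                def = (aL , dL) , ≤-trans (s≤s (m≤m+n (value L) new)) lt
                -- Without `e` the deficit is at most one, so a family still deficient after the
                -- orientation leaves no room for the new dyperedge.
                new≡0 : new ≡ 0
                new≡0 = n<1⇒n≡0 (+-cancelˡ-< (value L) new 1
                  (≤-trans lt (≤-trans (covered-suc L (aL , dL)) (≤-reflexive (+-comm 1 (value L))))))
            in none L def λ { (X , X∈ , w∈X) → avoid def new≡0 X∈ w∈X }
          where
          -- As no member is entered, a member containing `w` contains all of `e`. By disjointness
          -- it is the member crossed by `e`, which misses a vertex of `e`.
          avoid : Deficient L → sum (map (λ X → 𝟙 (enters e w D X)) L) ≡ 0 → ∀ {X} → X ∈ₗ L → w ∉ X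
          avoid def z {X} X∈ w∈X with crossesSome⁻ e D L (deficient-crossed def)
          ... | Y , Y∈ , (y , y∈e , y∈Y , y∈D) , (t , t∈e , t∉) =
            t∉ (x∈p∩q⁺ (subst (t ∈_) (disjoint-≡ dL X∈ Y∈ y∈D (e⊆X y∈e) y∈Y) (e⊆X t∈e) , e⊆D t∈e))
            where
            e⊆X : e ⊆ X
            e⊆X {u} u∈e = decidable-stable (u ∈? X) λ u∉X → 1+n≰n (≤-trans
              (≤-reflexive (sym (cong 𝟙 (enters⁺ e D X w∈X (e⊆D w∈e) u∈e u∉X))))
              (≤-trans (sum-member (λ X → 𝟙 (enters e w D X)) X∈) (≤-reflexive z)))

      -- Intersecting a deficient family containing w with one avoiding w gives a deficient family meeting
      -- e in fewer vertices.
      legal-head : ¬ (∀ w → w ∈ e → ¬ Covered-after w)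
      -- Since `x₀` is not a legal head, some deficient family exists, and the descent starts from
      -- it.
      legal-head illegal = illegal x₀ x₀∈e (legal x₀ x₀∈e λ L def _ → descend L def (<-wellFounded _))
        where
        x₀∈e : x₀ ∈ e
        x₀∈e = proj₁ (proj₂ e-comp)
        descend : ∀ L → Deficient L → Acc _<_ ∣ trace L ∣ → Empty.⊥
        descend L def (acc rs) with crossesSome⁻ e D L (deficient-crossed def)
        ... | X , X∈ , (w , w∈e , w∈X , _) , _ = illegal w w∈e (legal w w∈e λ Q defQ w∉Q →
          let open Lattice (lattice L Q (proj₁ def) (proj₁ defQ)) in
          descend meet (deficient-meet def defQ) (rs (p⊂q⇒∣p∣<∣q∣
            ( (λ x∈ → let x∈e , x∈m = ∈-comprehension⁻ (trace? meet) x∈ in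
                      ∈-comprehension⁺ (trace? L) (x∈e , proj₁ (meet-⊆ (e⊆D x∈e) x∈m)))
            , w , ∈-comprehension⁺ (trace? L) (w∈e , X , X∈ , w∈X)
            , λ w∈ → w∉Q (proj₂ (meet-⊆ (e⊆D w∈e) (proj₂ (∈-comprehension⁻ (trace? meet) w∈))))))))

    -- Without hyperedges the members of a family contribute independently, so the condition reduces
    -- to one on single bisets.
    Oriented : ∀ {m} → (Fin m → Subset n) → Weight → (Fin m → Fin n) → Set
    Oriented he b h = ∀ v → v ∉ R → ∀ X → Admissible (C v) X →
      k v ≤ b (C v) X + count (λ i → enters (he i) (h i) (C v) X)

    oriented? : ∀ {m} (he : Fin m → Subset n) b h → Dec (Oriented he b h)
    oriented? he b h = all? λ v → ¬? (v ∈? R) →-dec all-subsets (λ X →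
      admissible? (C v) X →-dec (_ ≤? _))
      where
      all-subsets : {Q : Subset n → Set} → (∀ X → Dec (Q X)) → Dec (∀ X → Q X)
      all-subsets Q? with anySubset? (λ X → ¬? (Q? X))
      ... | yes (X , ¬q) = no λ f → ¬q (f X)
      ... | no none = yes λ X → decidable-stable (Q? X) λ ¬q → none (X , ¬q)

    -- The families of bisets range over an infinite type, so a legal head is only found up to double
    -- negation; the condition on single bisets that remains at the end is decidable, hence stable.
    private
      orient¬¬ : ∀ {m} (he : Fin m → Subset n) b → Submodular b → Covered he b → (∀ i → InComponent (he i)) →
        ¬ ¬ (∃[ h ] ((∀ i → lookup h i ∈ he i) × Oriented he b (lookup h)))
      orient¬¬ {zero} he b sb cov comp ¬∃ = ¬∃ ([] , (λ ()) , λ v v∉ X aX → 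
        subst (_≤ b (C v) X + 0) (*-identityˡ (k v)) (cov v v∉ (X ∷ []) (aX ∷ []) ([] ∷ [])))
      orient¬¬ {suc m} he b sb cov comp ¬∃ = Trim.legal-head he b sb cov (comp zero) λ w w∈ covw →
        orient¬¬ (he ∘ suc) (b ⊕ he zero ⟶ w) (submodular-⊕ {b} (he zero) w sb) covw (comp ∘ suc) λ { (h , h∈ , or) →
          ¬∃ (w ∷ h , (λ { zero → w∈ ; (suc i) → h∈ i }) , λ v v∉ X aX →
            ≤-trans (or v v∉ X aX) (≤-reflexive (+-assoc (b (C v) X) _ _))) }

      anyVec? : ∀ {m} {Q : Vec (Fin n) m → Set} → (∀ h → Dec (Q h)) → Dec (∃ Q)
      anyVec? {zero} Q? = map′ (λ q → [] , q) (λ { ([] , q) → q }) (Q? [])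
      anyVec? {suc m} Q? = map′ (λ { (x , h , q) → x ∷ h , q }) (λ { (x ∷ h , q) → x , h , q })
        (any? λ x → anyVec? λ h → Q? (x ∷ h))

    orient : ∀ {m} (he : Fin m → Subset n) b → Submodular b → Covered he b → (∀ i → InComponent (he i)) →
      ∃[ h ] ((∀ i → h i ∈ he i) × Oriented he b h)
    orient he b sb cov comp =
      let h , p = decidable-stable
            (anyVec? λ h → all? (λ i → lookup h i ∈? he i) ×-dec oriented? he b (lookup h))
            (orient¬¬ he b sb cov comp)
      in lookup h , p

  -- Arborescences

  module _ {A : Set} where

    collect : ∀ {m} → (Fin m → Maybe A) → List A
    collect F = catMaybes (List.tabulate F)

    collect-cong : ∀ {m} {F G : Fin m → Maybe A} → F ≗ G → collect F ≡ collect G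
    collect-cong e = cong catMaybes (tabulate-cong e)

    collect-nothing : ∀ m → collect {m} (λ _ → nothing) ≡ []
    collect-nothing zero = refl
    collect-nothing (suc m) = collect-nothing m

    -- The list follows the order of the indices, so one more assigned index inserts its arc
    -- somewhere in the middle; `arborescence-leaf` expects this shape.
    collect-insert : ∀ {m} (F G : Fin m → Maybe A) a x → F a ≡ nothing → G a ≡ just x → (∀ i → i ≢ a → F i ≡ G i) →
      ∃[ xs ] ∃[ ys ] (collect F ≡ xs ++ ys × collect G ≡ xs ++ x ∷ ys)
    collect-insert F G zero x e e′ same rewrite e | e′ =
      [] , collect (F ∘ suc) , refl , cong (x ∷_) (sym (collect-cong λ i → same (suc i) λ ()))
    collect-insert F G (suc a) x e e′ same
      with collect-insert (F ∘ suc) (G ∘ suc) a x e e′ (λ i i≢a → same (suc i) (i≢a ∘ Fin.suc-injective))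
    ... | xs , ys , p , q with F zero | G zero | same zero (λ ())
    ... | nothing | _ | refl = xs , ys , p , q
    ... | just y | _ | refl = y ∷ xs , ys , cong (y ∷_) p , cong (y ∷_) q

    collect-↑ : ∀ m {k} (F : Fin (m + k) → Maybe A) →
      collect F ≡ collect (λ i → F (i ↑ˡ k)) ++ collect (λ i → F (m ↑ʳ i))
    collect-↑ zero F = refl
    collect-↑ (suc m) F with F zero
    ... | nothing = collect-↑ m (F ∘ suc)
    ... | just x = cong (x ∷_) (collect-↑ m (F ∘ suc))

    ∈-collect⁻ : ∀ {m} (F : Fin m → Maybe A) {x} → x ∈ₗ collect F → ∃[ i ] F i ≡ just x
    ∈-collect⁻ {suc m} F x∈ with F zero in eq
    ... | nothing = let i , e = ∈-collect⁻ (F ∘ suc) x∈ in suc i , e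
    ... | just y with x∈
    ... | here refl = zero , eq
    ... | there x∈′ = let i , e = ∈-collect⁻ (F ∘ suc) x∈′ in suc i , e

  module _ {n : ℕ} where

    indeg-++ : ∀ (xs ys : List (Arc n)) w → indeg (xs ++ ys) w ≡ indeg xs w + indeg ys w
    indeg-++ xs ys w rewrite filter-++ (λ p → proj₂ p ≟ w) xs ys = length-++ (filter (λ p → proj₂ p ≟ w) xs)

    indeg-insert-≢ : ∀ (xs ys : List (Arc n)) u v w → v ≢ w → indeg (xs ++ (u , v) ∷ ys) w ≡ indeg (xs ++ ys) w
    indeg-insert-≢ xs ys u v w v≢w rewrite indeg-++ xs ((u , v) ∷ ys) w | indeg-++ xs ys w
      | dec-false (v ≟ w) v≢w = refl

    indeg-insert-≡ : ∀ (xs ys : List (Arc n)) u v → indeg (xs ++ (u , v) ∷ ys) v ≡ suc (indeg (xs ++ ys) v)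
    indeg-insert-≡ xs ys u v rewrite indeg-++ xs ((u , v) ∷ ys) v | indeg-++ xs ys v
      | dec-true (v ≟ v) refl = +-suc (indeg xs v) (indeg ys v)

    ∈-insert⁺ : ∀ (xs : List (Arc n)) {ys a p} → p ∈ₗ xs ++ ys → p ∈ₗ xs ++ a ∷ ys
    ∈-insert⁺ xs p∈ = [ ∈-++⁺ˡ , ∈-++⁺ʳ xs ∘ there ]′ (∈-++⁻ xs p∈)

    ∈-insert⁻ : ∀ (xs : List (Arc n)) {ys a p} → p ∈ₗ xs ++ a ∷ ys → p ≡ a ⊎ p ∈ₗ xs ++ ys
    ∈-insert⁻ xs p∈ with ∈-++⁻ xs p∈
    ... | inj₁ p∈xs = inj₂ (∈-++⁺ˡ p∈xs)
    ... | inj₂ (here e) = inj₁ e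
    ... | inj₂ (there p∈ys) = inj₂ (∈-++⁺ʳ xs p∈ys)

    arborescence-trivial : ∀ (r : Fin n) → IsArborescence r ⁅ r ⁆ []
    arborescence-trivial r = x∈⁅x⁆ r , (λ _ _ ()) , (λ v v∈ → subst (Star (UAdj []) r) (sym (x∈⁅y⁆⇒x≡y r v∈)) ε) ,
      sym (∣⁅x⁆∣≡1 r) , refl , λ v v∈ v≢r → ⊥-elim (v≢r (x∈⁅y⁆⇒x≡y r v∈))

    arborescence-leaf : ∀ {r U} xs ys {u v : Fin n} → IsArborescence r U (xs ++ ys) → u ∈ U → v ∉ U →
      IsArborescence r (U ∪ ⁅ v ⁆) (xs ++ (u , v) ∷ ys)
    arborescence-leaf {r} {U} xs ys {u} {v} (r∈ , ends , conn , len , deg-r , deg) u∈ v∉ =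
      p⊆p∪q _ r∈ ,
      (λ x y a∈ → [ (λ { refl → p⊆p∪q _ u∈ , q⊆p∪q U _ (x∈⁅x⁆ v) })
                  , (λ a∈′ → let p , q = ends x y a∈′ in p⊆p∪q _ p , p⊆p∪q _ q) ]′ (∈-insert⁻ xs a∈)) ,
      (λ w w∈ → [ (λ w∈U → old (conn w w∈U))
                , (λ w∈v → subst (Star (UAdj (xs ++ (u , v) ∷ ys)) r) (sym (x∈⁅y⁆⇒x≡y v w∈v))
                    (old (conn u u∈) ◅◅ (inj₁ (∈-++⁺ʳ xs (here refl)) ◅ ε))) ]′ (∪⁻ w∈)) ,
      trans (cong (_+ 1) (trans (length-++ xs) (trans (+-suc (length xs) (length ys)) (cong suc (sym (length-++ xs))))))
        (trans (cong suc len) (sym (card-insert v∉))) ,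
      trans (indeg-insert-≢ xs ys u v r (λ { refl → v∉ r∈ })) deg-r ,
      newdeg
      where
      old : ∀ {x y} → Star (UAdj (xs ++ ys)) x y → Star (UAdj (xs ++ (u , v) ∷ ys)) x y
      old ε = ε
      old (inj₁ a ◅ p) = inj₁ (∈-insert⁺ xs a) ◅ old p
      old (inj₂ a ◅ p) = inj₂ (∈-insert⁺ xs a) ◅ old p
      newdeg : ∀ w → w ∈ U ∪ ⁅ v ⁆ → w ≢ r → indeg (xs ++ (u , v) ∷ ys) w ≡ 1
      newdeg w w∈ w≢r with v ≟ w
      ... | no v≢w = trans (indeg-insert-≢ xs ys u v w v≢w)
        (deg w ([ (λ p → p) , (λ w∈v → ⊥-elim (v≢w (sym (x∈⁅y⁆⇒x≡y v w∈v)))) ]′ (∪⁻ w∈)) w≢r)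
      -- All old arcs end in `U`, so the in-degree of `v` comes from the new arc alone.
      ... | yes refl = trans (indeg-insert-≡ xs ys u v) (cong suc (cong length
        (filter-none (λ p → proj₂ p ≟ v) (All.tabulate λ { {x , y} p∈ refl → v∉ (proj₂ (ends x y p∈)) }))))

  -- Named versions of the functions local to `rootArcs`. `pick` takes the head as a parameter, so
  -- it also serves hyperedges whose head has been fixed.
  pick : ∀ {n} → Fin n → Fin n → Maybe (Fin n × Fin n) → Maybe (Arc n)
  pick r h nothing = nothing
  pick r h (just (r′ , u)) = if ⌊ r′ ≟ r ⌋ then just (u , h) else nothing

  pick₃ : ∀ {n} → Fin n → Maybe (Fin n × Fin n × Fin n) → Maybe (Arc n)
  pick₃ r nothing = nothing
  pick₃ r (just (r′ , u , v)) = if ⌊ r′ ≟ r ⌋ then just (u , v) else nothing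

  module _ {n : ℕ} {r h : Fin n} where

    pick-other : ∀ {r′ u} → r′ ≢ r → pick r h (just (r′ , u)) ≡ nothing
    pick-other {r′} r′≢r with r′ ≟ r
    ... | yes e = ⊥-elim (r′≢r e)
    ... | no _ = refl

    pick-own : ∀ {u} → pick r h (just (r , u)) ≡ just (u , h)
    pick-own with r ≟ r
    ... | yes _ = refl
    ... | no r≢r = ⊥-elim (r≢r refl)

    pick⁻ : ∀ x {p} → pick r h x ≡ just p → ∃[ u ] (x ≡ just (r , u) × p ≡ (u , h))
    pick⁻ (just (r′ , u)) e with r′ ≟ r
    pick⁻ (just (r′ , u)) refl | yes refl = u , refl , refl

  pick₃⁻ : ∀ {n} {r : Fin n} x {p} → pick₃ r x ≡ just p → ∃[ u ] ∃[ v ] (x ≡ just (r , u , v) × p ≡ (u , v))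
  pick₃⁻ {r = r} (just (r′ , u , v)) e with r′ ≟ r
  pick₃⁻ {r = r} (just (r′ , u , v)) refl | yes refl = u , v , refl , refl

  module _ {n : ℕ} (H : MixedHypergraph n)
    (dy : Fin (nA H) → Maybe (Fin n × Fin n)) (hy : Fin (nE H) → Maybe (Fin n × Fin n × Fin n)) (r : Fin n) where

    private
      -- rootArcs is built from local functions that cannot be named from outside; unification recovers them.
      parts : ∀ {F : Fin (nA H) → Maybe (Arc n)} {G : Fin (nE H) → Maybe (Arc n)} →
        rootArcs H dy hy r ≡ mapMaybe F (allFin (nA H)) ++ mapMaybe G (allFin (nE H)) →
        (Fin (nA H) → Maybe (Arc n)) × (Fin (nE H) → Maybe (Arc n))
      parts {F} {G} _ = F , G

      F : Fin (nA H) → Maybe (Arc n)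
      F = proj₁ (parts refl)

      G : Fin (nE H) → Maybe (Arc n)
      G = proj₂ (parts refl)

      F-pick : ∀ a → F a ≡ pick r (hd H a) (dy a)
      F-pick a with dy a
      ... | nothing = refl
      ... | just _ = refl

      G-pick : ∀ e → G e ≡ pick₃ r (hy e)
      G-pick e with hy e
      ... | nothing = refl
      ... | just _ = refl

      mapMaybe-allFin : ∀ {m} (K : Fin m → Maybe (Arc n)) → mapMaybe K (allFin m) ≡ collect K
      mapMaybe-allFin K = cong catMaybes (map-tabulate (λ i → i) K)

    rootArcs-collect : rootArcs H dy hy r ≡ collect (λ a → pick r (hd H a) (dy a)) ++ collect (λ e → pick₃ r (hy e))
    rootArcs-collect = cong₂ _++_
      (trans (mapMaybe-allFin F) (collect-cong F-pick)) (trans (mapMaybe-allFin G) (collect-cong G-pick))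

  -- Simultaneous growth of the arborescences.

  module Growth {n : ℕ} (E : Fin n → Fin n → Set) (E? : ∀ u w → Dec (E u w))
    (R : Subset n) (ρ : Subset n → ℕ)
    (ρ-mono : ∀ {X Y} → X ⊆ Y → ρ X ≤ ρ Y)
    (ρ-submod : ∀ X Y → ρ (X ∪ Y) + ρ (X ∩ Y) ≤ ρ X + ρ Y)
    (ρ-∩R : ∀ X → ρ X ≤ ρ (X ∩ R))
    (E-∉R : ∀ {u w} → E u w → w ∉ R)
    {m : ℕ} (tail : Fin m → Subset n) (head : Fin m → Fin n)
    (tail-reach : ∀ a {u} → u ∈ tail a → Star E u (head a)) where

    open Components E E? R ρ

    Assignment : Set
    Assignment = Fin m → Maybe (Fin n × Fin n)

    initial : Fin n → Subset n
    initial v = if does (v ∈? R) then ⁅ v ⁆ else ⊥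

    -- S v is the set of roots whose growing arborescence already contains v.
    data Built : Assignment → (Fin n → Subset n) → Set where
      start : Built (λ _ → nothing) initial
      grow  : ∀ {α S} → Built α S → ∀ a u r → α a ≡ nothing → u ∈ tail a → r ∈ S u → head a ∉ R →
        ρ (S (head a)) < ρ (S (head a) ∪ ⁅ r ⁆) →
        Built (updateAt α a (λ _ → just (r , u))) (updateAt S (head a) (_∪ ⁅ r ⁆))

    initial⁻ : ∀ v {r} → r ∈ initial v → r ≡ v × v ∈ R
    initial⁻ v r∈ with v ∈? R
    ... | yes v∈R = x∈⁅y⁆⇒x≡y v r∈ , v∈R
    ... | no _ = ⊥-elim (∉⊥ r∈)

    initial⁺ : ∀ {v} → v ∈ R → v ∈ initial v
    initial⁺ {v} v∈R with v ∈? R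
    ... | yes _ = x∈⁅x⁆ v
    ... | no v∉R = ⊥-elim (v∉R v∈R)

    initial-∉R : ∀ {v} → v ∉ R → initial v ≡ ⊥
    initial-∉R {v} v∉R with v ∈? R
    ... | yes v∈R = ⊥-elim (v∉R v∈R)
    ... | no _ = refl

    grown⁻ : ∀ (S : Fin n → Subset n) h r v {s} → s ∈ updateAt S h (_∪ ⁅ r ⁆) v → s ∈ S v ⊎ (s ≡ r × v ≡ h)
    grown⁻ S h r v {s} s∈ with v ≟ h
    ... | no v≢h = inj₁ (subst (s ∈_) (updateAt-minimal v h S v≢h) s∈)
    ... | yes refl with ∪⁻ (subst (s ∈_) (updateAt-updates h S) s∈)
    ... | inj₁ s∈S = inj₁ s∈S
    ... | inj₂ s∈r = inj₂ (x∈⁅y⁆⇒x≡y r s∈r , refl)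

    grown⁺ : ∀ (S : Fin n → Subset n) h r v → S v ⊆ updateAt S h (_∪ ⁅ r ⁆) v
    grown⁺ S h r v {s} s∈ with v ≟ h
    ... | no v≢h = subst (s ∈_) (sym (updateAt-minimal v h S v≢h)) s∈
    ... | yes refl = subst (s ∈_) (sym (updateAt-updates h S)) (p⊆p∪q _ s∈)

    grown-new : ∀ (S : Fin n → Subset n) h r → r ∈ updateAt S h (_∪ ⁅ r ⁆) h
    grown-new S h r = subst (r ∈_) (sym (updateAt-updates h S)) (q⊆p∪q (S h) _ (x∈⁅x⁆ r))

    built-⊆P : ∀ {α S} → Built α S → ∀ {v} → S v ⊆ P v
    built-⊆P start {v} r∈ with initial⁻ v r∈
    ... | refl , _ = P⁺ ε
    built-⊆P (grow {S = S} B a u r _ u∈ r∈S _ _) {v} s∈ with grown⁻ S (head a) r v s∈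
    ... | inj₁ s∈S = built-⊆P B s∈S
    ... | inj₂ (refl , refl) = P-⊆ (tail-reach a u∈) (built-⊆P B r∈S)

    built-⊆R : ∀ {α S} → Built α S → ∀ {v} → S v ⊆ R
    built-⊆R start {v} r∈ with initial⁻ v r∈
    ... | refl , v∈R = v∈R
    built-⊆R (grow {S = S} B a u r _ _ r∈S _ _) {v} s∈ with grown⁻ S (head a) r v s∈
    ... | inj₁ s∈S = built-⊆R B s∈S
    ... | inj₂ (refl , refl) = built-⊆R B r∈S

    fresh : ∀ (S : Fin n → Subset n) {v r} → ρ (S v) < ρ (S v ∪ ⁅ r ⁆) → r ∉ S v
    fresh S {v} {r} lt r∈ = <⇒≱ lt (ρ-mono λ x∈ →
      [ (λ y → y) , (λ x∈r → subst (_∈ S v) (sym (x∈⁅y⁆⇒x≡y r x∈r)) r∈) ]′ (∪⁻ x∈))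

    -- Every growth step adds one element and raises the rank by at least one; non-root vertices
    -- start from the empty set.
    built-independent : ∀ {α S} → Built α S → ∀ {v} → v ∉ R → ∣ S v ∣ ≤ ρ (S v)
    built-independent start v∉R rewrite initial-∉R v∉R | ∣⊥∣≡0 n = z≤n
    built-independent (grow {S = S} B a u r _ _ _ h∉R lt) {v} v∉R with v ≟ head a
    ... | no v≢h rewrite updateAt-minimal v (head a) {_∪ ⁅ r ⁆} S v≢h = built-independent B v∉R
    ... | yes refl rewrite updateAt-updates (head a) {_∪ ⁅ r ⁆} S =
      ≤-trans (≤-reflexive (card-insert (fresh S lt))) (≤-trans (s≤s (built-independent B v∉R)) lt)

    free : Assignment → Fin m → Bool
    free α a = is-nothing (α a)

    free⁻ : ∀ (α : Assignment) a → free α a ≡ true → α a ≡ nothing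
    free⁻ α a e with α a
    ... | nothing = refl

    indegree : Assignment → Subset n → Subset n → ℕ
    indegree α D X = count (λ a → free α a ∧ enters (tail a) (head a) D X)

    indegree-submod : ∀ α D X Y → indegree α D (X ∪ Y) + indegree α D (X ∩ Y) ≤ indegree α D X + indegree α D Y
    indegree-submod α D X Y = count-exchange
      {p = into (X ∪ Y)} {into (X ∩ Y)} {into X} {into Y} pointwise
      where
      into : Subset n → Fin m → Bool
      into Z a = free α a ∧ enters (tail a) (head a) D Z
      pointwise : ∀ a → 𝟙 (into (X ∪ Y) a) + 𝟙 (into (X ∩ Y) a) ≤ 𝟙 (into X a) + 𝟙 (into Y a)
      pointwise a with free α a
      ... | true = enters-submod (tail a) (head a) D X Y
      ... | false = z≤n

    gathered? : ∀ (S : Fin n → Subset n) X r → Dec (∃[ v ] (v ∈ X × r ∈ S v))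
    gathered? S X r = any? (λ v → (v ∈? X) ×-dec (r ∈? S v))

    -- The roots available inside `X`: at the start these are `X ∩ R`, later all roots whose trees
    -- have reached `X`.
    gather : (Fin n → Subset n) → Subset n → Subset n
    gather S X = comprehension (gathered? S X)

    gather⁺ : ∀ S X {r v} → v ∈ X → r ∈ S v → r ∈ gather S X
    gather⁺ S X {v = v} v∈ r∈ = ∈-comprehension⁺ (gathered? S X) (v , v∈ , r∈)

    gather⁻ : ∀ S X {r} → r ∈ gather S X → ∃[ v ] (v ∈ X × r ∈ S v)
    gather⁻ S X = ∈-comprehension⁻ (gathered? S X)

    gather-∩ : ∀ S X Y → gather S (X ∩ Y) ⊆ gather S X ∩ gather S Y
    gather-∩ S X Y r∈ = let v , v∈ , r∈S = gather⁻ S (X ∩ Y) r∈ ; v∈X , v∈Y = ∩⁻ v∈ in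
      x∈p∩q⁺ (gather⁺ S X v∈X r∈S , gather⁺ S Y v∈Y r∈S)

    gather-∪ : ∀ S X Y → gather S (X ∪ Y) ⊆ gather S X ∪ gather S Y
    gather-∪ S X Y r∈ = let v , v∈ , r∈S = gather⁻ S (X ∪ Y) r∈ in
      [ (λ v∈X → p⊆p∪q _ (gather⁺ S X v∈X r∈S)) , (λ v∈Y → q⊆p∪q (gather S X) _ (gather⁺ S Y v∈Y r∈S)) ]′ (∪⁻ v∈)

    Spans : Subset n → Subset n → Set
    Spans Z T = ρ (Z ∪ T) ≤ ρ Z

    -- Submodularity for `Z ∪ A` and `Z ∪ B`, whose intersection contains `Z`.
    spans-∪ : ∀ {Z A B T} → Spans Z A → Spans Z B → T ⊆ A ∪ B → Spans Z T
    spans-∪ {Z} {A} {B} {T} sA sB T⊆ = +-cancelʳ-≤ (ρ Z) _ _ (begin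
      ρ (Z ∪ T) + ρ Z                                   ≤⟨ +-mono-≤ (ρ-mono left) (ρ-mono right) ⟩
      ρ ((Z ∪ A) ∪ (Z ∪ B)) + ρ ((Z ∪ A) ∩ (Z ∪ B))     ≤⟨ ρ-submod (Z ∪ A) (Z ∪ B) ⟩
      ρ (Z ∪ A) + ρ (Z ∪ B)                             ≤⟨ +-mono-≤ sA sB ⟩
      ρ Z + ρ Z                                         ∎)
      where
      open ≤-Reasoning
      left : Z ∪ T ⊆ (Z ∪ A) ∪ (Z ∪ B)
      left x∈ = [ (λ x∈Z → p⊆p∪q _ (p⊆p∪q A x∈Z))
                , (λ x∈T → [ (λ x∈A → p⊆p∪q _ (q⊆p∪q Z A x∈A)) , (λ x∈B → q⊆p∪q (Z ∪ A) _ (q⊆p∪q Z B x∈B)) ]′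
                             (∪⁻ (T⊆ x∈T))) ]′ (∪⁻ x∈)
      right : Z ⊆ (Z ∪ A) ∩ (Z ∪ B)
      right x∈ = x∈p∩q⁺ (p⊆p∪q A x∈ , p⊆p∪q B x∈)

    -- Submodularity for `Z ∪ T` and `T ∪ U`, whose intersection contains `T`.
    spans-trans : ∀ {Z T U} → Spans Z T → Spans T U → Spans Z U
    spans-trans {Z} {T} {U} sT sU = +-cancelʳ-≤ (ρ T) _ _ (begin
      ρ (Z ∪ U) + ρ T                                   ≤⟨ +-mono-≤ (ρ-mono left) (ρ-mono right) ⟩
      ρ ((Z ∪ T) ∪ (T ∪ U)) + ρ ((Z ∪ T) ∩ (T ∪ U))     ≤⟨ ρ-submod (Z ∪ T) (T ∪ U) ⟩
      ρ (Z ∪ T) + ρ (T ∪ U)                             ≤⟨ +-mono-≤ sT sU ⟩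
      ρ Z + ρ T                                         ∎)
      where
      open ≤-Reasoning
      left : Z ∪ U ⊆ (Z ∪ T) ∪ (T ∪ U)
      left x∈ = [ (λ x∈Z → p⊆p∪q _ (p⊆p∪q T x∈Z)) , (λ x∈U → q⊆p∪q (Z ∪ T) _ (q⊆p∪q T U x∈U)) ]′ (∪⁻ x∈)
      right : T ⊆ (Z ∪ T) ∩ (T ∪ U)
      right x∈ = x∈p∩q⁺ (q⊆p∪q Z T x∈ , p⊆p∪q U x∈)

    spans-⊆ : ∀ {Z T U} → Spans Z T → U ⊆ T → Spans Z U
    spans-⊆ {Z} {T} s U⊆ = ≤-trans (ρ-mono (λ x∈ → [ p⊆p∪q T , q⊆p∪q Z T ∘ U⊆ ]′ (∪⁻ x∈))) s

    spans-self : ∀ {Z} → Spans Z Z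
    spans-self = ρ-mono (λ x∈ → [ (λ y → y) , (λ y → y) ]′ (∪⁻ x∈))

    spans-elements : ∀ {Z} T → (∀ {r} → r ∈ T → Spans Z ⁅ r ⁆) → Spans Z T
    spans-elements {Z} T all = go T (<-wellFounded _) (λ x∈ → x∈)
      where
      go : ∀ U → Acc _<_ ∣ U ∣ → U ⊆ T → Spans Z U
      go U (acc rs) U⊆ with nonempty? U
      ... | no empty = ρ-mono (λ x∈ → [ (λ y → y) , (λ x∈U → ⊥-elim (empty (_ , x∈U))) ]′ (∪⁻ x∈))
      ... | yes (x , x∈U) = spans-∪ (go (U Subset.- x) (rs (x∈p⇒∣p-x∣<∣p∣ x∈U)) (U⊆ ∘ p─q⊆p U ⁅ x ⁆)) (all (U⊆ x∈U))
        λ {y} y∈U → split y y∈U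
        where
        split : ∀ y → y ∈ U → y ∈ (U Subset.- x) ∪ ⁅ x ⁆
        split y y∈U with y ≟ x
        ... | yes refl = q⊆p∪q (U Subset.- x) _ (x∈⁅x⁆ x)
        ... | no y≢x = p⊆p∪q _ (x∈p∧x≢y⇒x∈p-y y∈U y≢x)

    -- The invariant of the growth: the free dyperedges entering `X` and the roots already present
    -- in `X` together still meet the demand.
    Feasible : Assignment → (Fin n → Subset n) → Set
    Feasible α S = ∀ v → v ∉ R → ∀ X → Admissible (C v) X → k v ≤ indegree α (C v) X + ρ (gather S X)

    record Extension (α : Assignment) (S : Fin n → Subset n) : Set where
      field
        {α′}     : Assignment
        {S′}     : Fin n → Subset n
        built    : Built α′ S′
        feasible : Feasible α′ S′
        smaller  : count (free α′) < count (free α)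

    -- The component of v₀ is to be extended, all components before it being saturated.
    module Extend {α S} (B : Built α S) (feas : Feasible α S) (v₀ : Fin n) (v₀∉R : v₀ ∉ R)
      (saturated : ∀ {w} → w ∈ P v₀ → w ∉ C v₀ → w ∉ R → k w ≤ ρ (S w)) where

      private
        D : Subset n
        D = C v₀
        κ : ℕ
        κ = k v₀
        d : Subset n → ℕ
        d = indegree α D
        g : Subset n → Subset n
        g = gather S

      D-∉R : ∀ {w} → w ∈ D → w ∉ R
      D-∉R w∈ w∈R = go (proj₂ (C⁻ w∈)) v₀∉R w∈R
        where
        go : ∀ {u w} → Star E u w → u ∉ R → w ∉ R
        go ε u∉ = u∉
        go (e ◅ p) _ = go p (E-∉R e)

      -- Feasibility gives the converse inequality for admissible sets, so these then have equality.
      Tight : Subset n → Set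
      Tight X = d X + ρ (g X) ≤ κ

      -- With the whole tail in `X`, any blocking set, being entered by `a`, misses a vertex of `X`;
      -- this makes the search shrink.
      Useful : Subset n → Fin m → Fin n → Fin n → Set
      Useful X a u r = free α a ≡ true × tail a ⊆ X × head a ∈ X × head a ∈ D × u ∈ tail a × r ∈ S u ×
        ρ (S (head a)) < ρ (S (head a) ∪ ⁅ r ⁆)

      useful? : ∀ X → Dec (∃[ a ] ∃[ u ] ∃[ r ] Useful X a u r)
      useful? X = any? λ a → any? λ u → any? λ r → (free α a Bool.≟ true) ×-dec (tail a ⊆? X) ×-dec
        (head a ∈? X) ×-dec (head a ∈? D) ×-dec (u ∈? tail a) ×-dec (r ∈? S u) ×-dec (_ <? _)

      -- Refutes a tight `X` without useful steps. The set `Y` of vertices that can feed `v` inside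
      -- `X` has in-degree at most that of `X`, and its roots are spanned by `S v`, whose rank is
      -- below that of `g X`. So `Y` would violate feasibility.
      module NoUseful (X : Subset n) (aX : Admissible D X) (X⊆P : X ⊆ P v₀) (tight : Tight X)
        (v : Fin n) (v∈X : v ∈ X) (v∈D : v ∈ D) (lt : ρ (S v) < ρ (g X))
        (none : ¬ (∃[ a ] ∃[ u ] ∃[ r ] Useful X a u r)) where

        -- Inside the component only free dyperedges with tail in `X` are followed. In the wall
        -- every step is followed, which makes `Y` admissible.
        Q : Fin n → Fin n → Set
        Q y z = (∃[ a ] (free α a ≡ true × tail a ⊆ X × y ∈ tail a × head a ≡ z × z ∈ X × z ∈ D))
              ⊎ (E y z × z ∈ X × z ∉ D)

        Q? : ∀ y z → Dec (Q y z)
        Q? y z = (any? λ a → (free α a Bool.≟ true) ×-dec (tail a ⊆? X) ×-dec (y ∈? tail a) ×-dec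
                    (head a ≟ z) ×-dec (z ∈? X) ×-dec (z ∈? D))
           ⊎-dec (E? y z ×-dec (z ∈? X) ×-dec ¬? (z ∈? D))

        Y : Subset n
        Y = Closure.preds Q Q? v

        v∈Y : v ∈ Y
        v∈Y = Closure.self∈preds Q Q? v

        Y-closed : ∀ {y z} → Q y z → z ∈ Y → y ∈ Y
        Y-closed = Closure.preds-closed Q Q? v

        Y⊆X : Y ⊆ X
        Y⊆X y∈ = go (Closure.preds-sound Q Q? v y∈)
          where
          go : ∀ {y} → Star Q y v → y ∈ X
          go ε = v∈X
          go (inj₁ (a , _ , t⊆ , y∈ , _) ◅ _) = t⊆ y∈
          go (inj₂ (e , z∈X , z∉D) ◅ _) = proj₁ (proj₂ aX _ _ e z∈X z∉D)

        admissible-Y : Admissible D Y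
        admissible-Y = (v , v∈Y , v∈D) , λ u w e w∈ w∉D →
          Y-closed (inj₂ (e , Y⊆X w∈ , w∉D)) w∈ , proj₂ (proj₂ aX u w e (Y⊆X w∈) w∉D)

        -- If a free dyperedge with head in `Y ∩ D` had its tail inside `X`, closure under `Q` would
        -- put the whole tail into `Y`. Hence whatever enters `Y` also enters `X`.
        dY≤dX : d Y ≤ d X
        dY≤dX = count-mono λ a e → let fr , en = ∧-true⁻ (free α a) _ e in
          ∧-true⁺ fr (entersX a fr (enters⁻ (tail a) (head a) D Y en))
          where
          entersX : ∀ a → free α a ≡ true → head a ∈ Y × head a ∈ D × ∃[ t ] (t ∈ tail a × t ∉ Y) →
            enters (tail a) (head a) D X ≡ true
          entersX a fr (h∈Y , h∈D , t , t∈ , t∉Y) with any? (λ u → (u ∈? tail a) ×-dec ¬? (u ∈? X))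
          ... | yes (u , u∈ , u∉) = enters⁺ (tail a) D X (Y⊆X h∈Y) h∈D u∈ u∉
          ... | no ¬∃ = ⊥-elim (t∉Y (Y-closed (inj₁ (a , fr , t⊆X , t∈ , refl , Y⊆X h∈Y , h∈D)) h∈Y))
            where
            t⊆X : tail a ⊆ X
            t⊆X {u} u∈ = decidable-stable (u ∈? X) λ u∉ → ¬∃ (u , u∈ , u∉)

        -- Inside `D`, an unspanned root of `S y` would give a useful step. In the wall `z` is
        -- saturated, so `S z` spans all roots of `P z`, among them those of `P y`.
        spans-step : ∀ {y z} → Q y z → Spans (S z) (S y)
        spans-step {y} (inj₁ (a , fr , t⊆ , y∈ , refl , z∈X , z∈D)) = spans-elements (S y) λ {r} r∈ →
          ≮⇒≥ λ lt′ → none (a , y , r , fr , t⊆ , z∈X , z∈D , y∈ , r∈ , lt′)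
        spans-step {y} {z} (inj₂ (e , z∈X , z∉D)) =
          ≤-trans (ρ-mono (λ x∈ → [ built-⊆P B , P-⊆ (e ◅ ε) ∘ built-⊆P B ]′ (∪⁻ x∈))) (saturated (X⊆P z∈X) z∉D (E-∉R e))

        spans-Star : ∀ {y} → Star Q y v → Spans (S v) (S y)
        spans-Star ε = spans-self
        spans-Star (q ◅ p) = spans-trans (spans-Star p) (spans-step q)

        spans-Y : Spans (S v) (g Y)
        spans-Y = spans-elements (g Y) λ r∈ → let y , y∈ , r∈S = gather⁻ S Y r∈ in
          spans-⊆ (spans-Star (Closure.preds-sound Q Q? v y∈))
            (λ x∈ → subst (_∈ S y) (sym (x∈⁅y⁆⇒x≡y _ x∈)) r∈S)

        impossible : Empty.⊥
        impossible = <-irrefl refl (begin-strict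
          κ                 ≤⟨ feas v₀ v₀∉R Y admissible-Y ⟩
          d Y + ρ (g Y)     ≤⟨ +-mono-≤ dY≤dX (≤-trans (ρ-mono (q⊆p∪q (S v) (g Y))) spans-Y) ⟩
          d X + ρ (S v)     <⟨ +-monoʳ-< (d X) lt ⟩
          d X + ρ (g X)     ≤⟨ tight ⟩
          κ                 ∎)
          where open ≤-Reasoning

      -- These sets would lose their inequality: the step costs one unit of in-degree, there is no
      -- slack, and `r` does not raise the rank.
      Blocking : Fin m → Fin n → Subset n → Set
      Blocking a r X = Admissible D X × enters (tail a) (head a) D X ≡ true × Tight X × Spans (g X) ⁅ r ⁆

      blocking? : ∀ a r → Dec (∃[ X ] Blocking a r X)
      blocking? a r = anySubset? λ X → admissible? D X ×-dec (_ Bool.≟ true) ×-dec (_ ≤? _) ×-dec (_ ≤? _)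

      -- Only sets entered by `a` lose in-degree, and only by one. Such a set either has slack or,
      -- not being blocking, gains rank through `r`.
      unblocked : ∀ a u r → free α a ≡ true → head a ∈ D → u ∈ tail a → r ∈ S u →
        ρ (S (head a)) < ρ (S (head a) ∪ ⁅ r ⁆) → ¬ (∃[ X ] Blocking a r X) → Extension α S
      unblocked a u r fr h∈D u∈ r∈ lt none = record
        { built = grow B a u r (free⁻ α a fr) u∈ r∈ (D-∉R h∈D) lt
        ; feasible = feas′
        ; smaller = count-strict still-free a (cong is-nothing (updateAt-updates a α)) fr }
        where
        α′ : Assignment
        α′ = updateAt α a (λ _ → just (r , u))
        S′ : Fin n → Subset n
        S′ = updateAt S (head a) (_∪ ⁅ r ⁆)
        still-free : ∀ i → free α′ i ≡ true → free α i ≡ true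
        still-free i e with i ≟ a
        ... | yes refl = fr
        ... | no i≢a = trans (cong is-nothing (sym (updateAt-minimal i a α i≢a))) e
        remains : ∀ {i} → i ≢ a → free α i ≡ true → free α′ i ≡ true
        remains {i} i≢a e = trans (cong is-nothing (updateAt-minimal i a α i≢a)) e
        gather-grows : ∀ X → gather S X ⊆ gather S′ X
        gather-grows X s∈ = let v , v∈ , s∈S = gather⁻ S X s∈ in gather⁺ S′ X v∈ (grown⁺ S (head a) r v s∈S)
        feas′ : Feasible α′ S′
        feas′ v v∉R X aX with true-or-false (enters (tail a) (head a) (C v) X)
        ... | inj₂ notIn = ≤-trans (feas v v∉R X aX)
          (+-mono-≤ (count-mono λ i e → let fi , en = ∧-true⁻ (free α i) _ e in
                       ∧-true⁺ (remains (λ { refl → true≢false en notIn }) fi) en)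
                    (ρ-mono (gather-grows X)))
        -- `head a` lies in `C v` and in `D`, so the two components and their demands coincide.
        ... | inj₁ en = subst (λ z → z ≤ indegree α′ (C v) X + ρ (gather S′ X)) (cong ρ Pv₀≡) (split en aX)
          where
          h∈Cv : head a ∈ C v
          h∈Cv = proj₁ (proj₂ (enters⁻ (tail a) (head a) (C v) X en))
          Cv≡D : C v ≡ D
          Cv≡D = trans (sym (C-≡ h∈Cv)) (C-≡ h∈D)
          Pv₀≡ : P v₀ ≡ P v
          Pv₀≡ = trans (sym (P-≡ h∈D)) (P-≡ h∈Cv)
          split : enters (tail a) (head a) (C v) X ≡ true → Admissible (C v) X →
            κ ≤ indegree α′ (C v) X + ρ (gather S′ X)
          split rewrite Cv≡D = λ en aX → go en aX (d X + ρ (g X) ≤? κ)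
            where
            open ≤-Reasoning
            d≤ : d X ≤ suc (indegree α′ D X)
            d≤ = count-remove a λ i i≢a e → let fi , en′ = ∧-true⁻ (free α i) _ e in ∧-true⁺ (remains i≢a fi) en′
            go : enters (tail a) (head a) D X ≡ true → Admissible D X → Dec (Tight X) → κ ≤ indegree α′ D X + ρ (gather S′ X)
            go en aX (no slack) = ≤-pred (begin
              suc κ                                     ≤⟨ ≰⇒> slack ⟩
              d X + ρ (g X)                             ≤⟨ +-mono-≤ d≤ (ρ-mono (gather-grows X)) ⟩
              suc (indegree α′ D X + ρ (gather S′ X))   ∎)
            go en aX (yes tight) = begin
              κ                                         ≤⟨ feas v₀ v₀∉R X aX ⟩
              d X + ρ (g X)                             ≤⟨ +-monoˡ-≤ _ d≤ ⟩
              suc (indegree α′ D X) + ρ (g X)           ≡⟨ +-suc _ _ ⟨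
              indegree α′ D X + suc (ρ (g X))           ≤⟨ +-monoʳ-≤ _ (≰⇒> λ sp → none (X , aX , en , tight , sp)) ⟩
              indegree α′ D X + ρ (g X ∪ ⁅ r ⁆)         ≤⟨ +-monoʳ-≤ _ (ρ-mono into) ⟩
              indegree α′ D X + ρ (gather S′ X)         ∎
              where
              into : g X ∪ ⁅ r ⁆ ⊆ gather S′ X
              into x∈ = [ gather-grows X
                        , (λ x∈r → subst (_∈ gather S′ X) (sym (x∈⁅y⁆⇒x≡y r x∈r))
                             (gather⁺ S′ X (proj₁ (enters⁻ (tail a) (head a) D X en)) (grown-new S (head a) r))) ]′ (∪⁻ x∈)

      -- A tight set blocking the growth step (a , u , r) is intersected with X, which stays tight and
      -- loses a vertex of tail a.
      search : ∀ X → Acc _<_ ∣ X ∣ → Admissible D X → X ⊆ P v₀ → Tight X →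
        ∀ v → v ∈ X → v ∈ D → ρ (S v) < ρ (g X) → Extension α S
      search X (acc rs) aX X⊆P tight v v∈X v∈D lt with useful? X
      ... | no none = ⊥-elim (NoUseful.impossible X aX X⊆P tight v v∈X v∈D lt none)
      ... | yes (a , u , r , fr , t⊆X , h∈X , h∈D , u∈ , r∈ , lt′) with blocking? a r
      ... | no none = unblocked a u r fr h∈D u∈ r∈ lt′ none
      ... | yes (X′ , aX′ , en , tight′ , sp) with enters⁻ (tail a) (head a) D X′ en
      ... | h∈X′ , _ , t , t∈ , t∉X′ =
        search (X ∩ X′)
          (rs (p⊂q⇒∣p∣<∣q∣ (p∩q⊆p X X′ , t , t⊆X t∈ , λ t∈∩ → t∉X′ (proj₂ (∩⁻ {X = X} t∈∩)))))
          a∩ (X⊆P ∘ p∩q⊆p X X′)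
          (≤-trans (+-monoʳ-≤ (d (X ∩ X′)) (ρ-mono (p⊆p∪q ⁅ r ⁆))) tight∩)
          -- The unsaturated vertex of the new tight set is `head a`: its own roots do not span `r`,
          -- whereas those gathered in the intersection do.
          (head a) (x∈p∩q⁺ (h∈X , h∈X′)) h∈D
          (≤-trans lt′ (≤-trans (ρ-mono S⊆) spanned))
        where
        open ≤-Reasoning
        a∩ : Admissible D (X ∩ X′)
        a∩ = admissible-∩ aX aX′ h∈X h∈X′ h∈D
        r∈gX : r ∈ g X
        r∈gX = gather⁺ S X (t⊆X u∈) r∈
        -- Since `r` lies in `g X` and is spanned by `g X′`, it can be added to the intersection
        -- term at no cost.
        ranks : ρ (g (X ∪ X′)) + ρ (g (X ∩ X′) ∪ ⁅ r ⁆) ≤ ρ (g X) + ρ (g X′)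
        ranks = begin
          ρ (g (X ∪ X′)) + ρ (g (X ∩ X′) ∪ ⁅ r ⁆)                       ≤⟨ +-mono-≤ (ρ-mono left) (ρ-mono right) ⟩
          ρ (g X ∪ (g X′ ∪ ⁅ r ⁆)) + ρ (g X ∩ (g X′ ∪ ⁅ r ⁆))           ≤⟨ ρ-submod (g X) (g X′ ∪ ⁅ r ⁆) ⟩
          ρ (g X) + ρ (g X′ ∪ ⁅ r ⁆)                                    ≤⟨ +-monoʳ-≤ (ρ (g X)) sp ⟩
          ρ (g X) + ρ (g X′)                                            ∎
          where
          left : g (X ∪ X′) ⊆ g X ∪ (g X′ ∪ ⁅ r ⁆)
          left x∈ = [ p⊆p∪q _ , (λ x∈′ → q⊆p∪q (g X) _ (p⊆p∪q ⁅ r ⁆ x∈′)) ]′ (∪⁻ (gather-∪ S X X′ x∈))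
          right : g (X ∩ X′) ∪ ⁅ r ⁆ ⊆ g X ∩ (g X′ ∪ ⁅ r ⁆)
          right x∈ with ∪⁻ x∈
          ... | inj₁ x∈g = let p , q = ∩⁻ (gather-∩ S X X′ x∈g) in x∈p∩q⁺ (p , p⊆p∪q ⁅ r ⁆ q)
          ... | inj₂ x∈r = x∈p∩q⁺ (subst (_∈ g X) (sym (x∈⁅y⁆⇒x≡y r x∈r)) r∈gX , q⊆p∪q (g X′) _ x∈r)
        tight∩ : d (X ∩ X′) + ρ (g (X ∩ X′) ∪ ⁅ r ⁆) ≤ κ
        tight∩ = +-cancelˡ-≤ κ _ _ (begin
          κ + (d (X ∩ X′) + ρ (g (X ∩ X′) ∪ ⁅ r ⁆))
            ≤⟨ +-monoˡ-≤ _ (feas v₀ v₀∉R (X ∪ X′) (admissible-∪ aX aX′ h∈X h∈X′ h∈D)) ⟩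
          (d (X ∪ X′) + ρ (g (X ∪ X′))) + (d (X ∩ X′) + ρ (g (X ∩ X′) ∪ ⁅ r ⁆))
            ≤⟨ +-exchange-≤ {d (X ∪ X′)} {d (X ∩ X′)} {d X} {d X′} (indegree-submod α D X X′) ranks ⟩
          (d X + ρ (g X)) + (d X′ + ρ (g X′))
            ≤⟨ +-mono-≤ tight tight′ ⟩
          κ + κ ∎)
        -- Compares tightness with `r` included against feasibility without it.
        spanned : ρ (g (X ∩ X′) ∪ ⁅ r ⁆) ≤ ρ (g (X ∩ X′))
        spanned = +-cancelˡ-≤ (d (X ∩ X′)) _ _ (≤-trans tight∩ (feas v₀ v₀∉R (X ∩ X′) a∩))
        S⊆ : S (head a) ∪ ⁅ r ⁆ ⊆ g (X ∩ X′) ∪ ⁅ r ⁆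
        S⊆ x∈ = [ (λ x∈S → p⊆p∪q _ (gather⁺ S (X ∩ X′) (x∈p∩q⁺ (h∈X , h∈X′)) x∈S)) , q⊆p∪q (g (X ∩ X′)) _ ]′ (∪⁻ x∈)

      -- The search starts at `P v₀`: no dyperedge enters it and all roots gathered there belong to
      -- it, so it is tight.
      extend : ρ (S v₀) < κ → Extension α S
      extend lt = search (P v₀) (<-wellFounded _) aP (λ x∈ → x∈)
        (≤-trans (+-monoˡ-≤ _ (≤-reflexive no-entering)) (ρ-mono g⊆)) v₀ (P⁺ ε) (v∈Cv v₀)
        (≤-trans lt (≤-trans (feas v₀ v₀∉R (P v₀) aP) (+-monoˡ-≤ _ (≤-reflexive no-entering))))
        where
        aP : Admissible D (P v₀)
        aP = (v₀ , P⁺ ε , v∈Cv v₀) , λ u w e w∈ w∉ →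
          -- A predecessor in `D` would put `w` on a closed walk through `v₀`, hence into `D`.
          P⁺ (e ◅ P⁻ w∈) , λ u∈ → w∉ (C⁺ (P⁻ w∈) (proj₂ (C⁻ u∈) ◅◅ (e ◅ ε)))
        no-entering : d (P v₀) ≡ 0
        no-entering = count-false λ a → closed a (true-or-false (free α a ∧ enters (tail a) (head a) D (P v₀)))
          where
          closed : ∀ a → _ → free α a ∧ enters (tail a) (head a) D (P v₀) ≡ false
          closed a (inj₂ f) = f
          closed a (inj₁ t) with enters⁻ (tail a) (head a) D (P v₀) (proj₂ (∧-true⁻ (free α a) _ t))
          ... | h∈ , _ , u , u∈ , u∉ = ⊥-elim (u∉ (P⁺ (tail-reach a u∈ ◅◅ P⁻ h∈)))
        g⊆ : g (P v₀) ⊆ P v₀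
        g⊆ r∈ = let v , v∈ , r∈S = gather⁻ S (P v₀) r∈ in P-⊆ (P⁻ v∈) (built-⊆P B r∈S)

    Unsaturated : (Fin n → Subset n) → Fin n → Set
    Unsaturated S v = v ∉ R × ρ (S v) < k v

    unsaturated? : ∀ S v → Dec (Unsaturated S v)
    unsaturated? S v = ¬? (v ∈? R) ×-dec (_ <? _)

    -- Passing to an unsaturated `w` before the component of `v` shrinks the predecessor set: `v`
    -- itself drops out, as otherwise `w` would be in `C v`.
    first-unsaturated : ∀ S v → Acc _<_ ∣ P v ∣ → Unsaturated S v →
      ∃[ v₀ ] (Unsaturated S v₀ × (∀ {w} → w ∈ P v₀ → w ∉ C v₀ → w ∉ R → k w ≤ ρ (S w)))
    first-unsaturated S v (acc rs) un
      with any? (λ w → (w ∈? P v) ×-dec ¬? (w ∈? C v) ×-dec unsaturated? S w)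
    ... | yes (w , w∈P , w∉C , unw) = first-unsaturated S w
      (rs (p⊂q⇒∣p∣<∣q∣ (P-⊆ (P⁻ w∈P) , v , P⁺ ε , λ v∈ → w∉C (C⁺ (P⁻ w∈P) (P⁻ v∈))))) unw
    ... | no none = v , un , λ w∈P w∉C w∉R → ≮⇒≥ λ lt → none (_ , w∈P , w∉C , w∉R , lt)

    Complete : Set
    Complete = ∃[ α ] ∃[ S ] (Built α S × (∀ v → v ∉ R → k v ≤ ρ (S v)))

    complete-from : ∀ {α S} → Built α S → Feasible α S → Acc _<_ (count (free α)) → Complete
    complete-from {α} {S} B feas (acc rs) with any? (unsaturated? S)
    ... | no none = α , S , B , λ v v∉R → ≮⇒≥ λ lt → none (v , v∉R , lt)
    ... | yes (v , un) with first-unsaturated S v (<-wellFounded _) un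
    ... | v₀ , (v₀∉R , lt) , sat =
      let open Extension (Extend.extend B feas v₀ v₀∉R sat lt) in complete-from built feasible (rs smaller)

    -- At the start every root sits at itself, so `gather initial X` contains `X ∩ R` and the
    -- hypothesis yields feasibility.
    complete : (∀ v → v ∉ R → ∀ X → Admissible (C v) X → k v ≤ count (λ a → enters (tail a) (head a) (C v) X) + ρ X) →
      Complete
    complete cond = complete-from start
      (λ v v∉R X aX → ≤-trans (cond v v∉R X aX) (+-monoʳ-≤ _ (≤-trans (ρ-∩R X)
        (ρ-mono λ r∈ → let r∈X , r∈R = ∩⁻ r∈ in gather⁺ initial X r∈X (initial⁺ r∈R)))))
      (<-wellFounded _)

    span : (Fin n → Subset n) → Fin n → Subset n
    span S r = comprehension (λ v → r ∈? S v)

    span⁺ : ∀ (S : Fin n → Subset n) r {v} → r ∈ S v → v ∈ span S r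
    span⁺ S r = ∈-comprehension⁺ (λ v → r ∈? S v)

    span⁻ : ∀ (S : Fin n → Subset n) r {v} → v ∈ span S r → r ∈ S v
    span⁻ S r = ∈-comprehension⁻ (λ v → r ∈? S v)

    arcs : Assignment → Fin n → List (Arc n)
    arcs α r = collect (λ a → pick r (head a) (α a))

    -- The inequality `u ≢ head i` matters for hyperedges, whose tail contains the head; it holds
    -- because `r` is in `S u` but new at the head.
    built-assigned : ∀ {α S} → Built α S → ∀ i {r u} → α i ≡ just (r , u) → r ∈ R × u ∈ tail i × u ≢ head i
    built-assigned (grow {α} {S} B a u r _ u∈ r∈ _ lt) i e with i ≟ a
    ... | no i≢a = built-assigned B i (trans (sym (updateAt-minimal i a α i≢a)) e)
    ... | yes refl with trans (sym e) (updateAt-updates a α)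
    ... | refl = built-⊆R B r∈ , u∈ , λ { refl → fresh S lt r∈ }

    -- A growth step hangs `head a` as a new leaf on the tree of the chosen root and leaves the
    -- other trees unchanged.
    built-arborescence : ∀ {α S} → Built α S → ∀ {r} → r ∈ R → IsArborescence r (span S r) (arcs α r)
    built-arborescence start {r} r∈R
      rewrite collect-nothing {A = Arc n} m
      | ⊆-antisym {i = span initial r} {⁅ r ⁆}
          (λ {x} x∈ → subst (_∈ ⁅ r ⁆) (proj₁ (initial⁻ x (span⁻ initial r x∈))) (x∈⁅x⁆ r))
          (λ {x} x∈ → subst (_∈ span initial r) (sym (x∈⁅y⁆⇒x≡y r x∈)) (span⁺ initial r (initial⁺ r∈R)))
      = arborescence-trivial r
    built-arborescence (grow {α} {S} B a u r′ free-a u∈ r∈ h∉R lt) {r} r∈R with r′ ≟ r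
    ... | no r′≢r = subst₂ (IsArborescence r)
        (⊆-antisym (span⁺ S′ r ∘ grown⁺ S (head a) r′ _ ∘ span⁻ S r)
          (λ {v} v∈ → [ span⁺ S r , (λ { (refl , _) → ⊥-elim (r′≢r refl) }) ]′ (grown⁻ S (head a) r′ v (span⁻ S′ r v∈))))
        (collect-cong same) (built-arborescence B r∈R)
      where
      S′ : Fin n → Subset n
      S′ = updateAt S (head a) (_∪ ⁅ r′ ⁆)
      same : ∀ i → pick r (head i) (α i) ≡ pick r (head i) (updateAt α a (λ _ → just (r′ , u)) i)
      same i with i ≟ a
      ... | no i≢a = cong (pick r (head i)) (sym (updateAt-minimal i a α i≢a))
      ... | yes refl = trans (cong (pick r (head a)) free-a)
        (sym (trans (cong (pick r (head a)) (updateAt-updates a α)) (pick-other r′≢r)))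
    ... | yes refl
      with collect-insert (λ i → pick r (head i) (α i)) (λ i → pick r (head i) (updateAt α a (λ _ → just (r , u)) i))
             a (u , head a) (cong (pick r (head a)) free-a) added
             (λ i i≢a → cong (pick r (head i)) (sym (updateAt-minimal i a α i≢a)))
      where
      added : pick r (head a) (updateAt α a (λ _ → just (r , u)) a) ≡ just (u , head a)
      added = trans (cong (pick r (head a)) (updateAt-updates a α)) pick-own
    ... | xs , ys , before , after = subst₂ (IsArborescence r) U≡ (sym after)
        (arborescence-leaf xs ys (subst (IsArborescence r (span S r)) before (built-arborescence B r∈R))
          (span⁺ S r r∈) (fresh S lt ∘ span⁻ S r))
      where
      S′ : Fin n → Subset n
      S′ = updateAt S (head a) (_∪ ⁅ r ⁆)
      U≡ : span S r ∪ ⁅ head a ⁆ ≡ span S′ r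
      U≡ = ⊆-antisym
        (λ x∈ → [ span⁺ S′ r ∘ grown⁺ S (head a) r _ ∘ span⁻ S r
                , (λ x∈h → subst (_∈ span S′ r) (sym (x∈⁅y⁆⇒x≡y (head a) x∈h)) (span⁺ S′ r (grown-new S (head a) r))) ]′ (∪⁻ x∈))
        (λ {v} v∈ → [ (λ r∈S → p⊆p∪q _ (span⁺ S r r∈S)) , (λ { (_ , refl) → q⊆p∪q (span S r) _ (x∈⁅x⁆ (head a)) }) ]′
                      (grown⁻ S (head a) r v (span⁻ S′ r v∈)))

  -- Passage between lists and indexed families, integers and naturals.

  any-lookup : ∀ {A : Set} (p : A → Bool) L → anyFin (λ i → p (List.lookup L i)) ≡ any p L
  any-lookup p [] = refl
  any-lookup p (x ∷ L) = cong (p x ∨_) (any-lookup p L)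

  sum-lookup : ∀ {A : Set} (f : A → ℕ) L → sumℕ (λ i → f (List.lookup L i)) ≡ sum (map f L)
  sum-lookup f [] = refl
  sum-lookup f (x ∷ L) = cong (f x +_) (sum-lookup f L)

  AllPairs-lookup : ∀ {A : Set} {_~_ : A → A → Set} {L} → (∀ {x y} → x ~ y → y ~ x) → AllPairs _~_ L →
    ∀ i j → i ≢ j → List.lookup L i ~ List.lookup L j
  AllPairs-lookup s (a ∷ as) zero zero i≢j = ⊥-elim (i≢j refl)
  AllPairs-lookup {L = _ ∷ L} s (a ∷ as) zero (suc j) i≢j = All.lookup a (∈-lookup {xs = L} j)
  AllPairs-lookup {L = _ ∷ L} s (a ∷ as) (suc i) zero i≢j = s (All.lookup a (∈-lookup {xs = L} i))
  AllPairs-lookup s (a ∷ as) (suc i) (suc j) i≢j = AllPairs-lookup s as i j (i≢j ∘ cong suc)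

  -- Adding back the subtracted ranks turns the integer inequality of the theorem into one between
  -- naturals.
  sumℤ-+ : ∀ {ℓ} a (c : Fin ℓ → ℕ) → sumℤ (λ i → ℤ.+ a ℤ.- ℤ.+ c i) ℤ.+ ℤ.+ sumℕ c ≡ ℤ.+ (ℓ * a)
  sumℤ-+ {zero} a c = refl
  sumℤ-+ {suc ℓ} a c = trans
    (trans (cong (λ z → (ℤ.+ a ℤ.- ℤ.+ c zero) ℤ.+ sumℤ (λ i → ℤ.+ a ℤ.- ℤ.+ c (suc i)) ℤ.+ z) (ℤ.pos-+ (c zero) _))
           (regroup (ℤ.+ a) (ℤ.+ c zero) (sumℤ (λ i → ℤ.+ a ℤ.- ℤ.+ c (suc i))) (ℤ.+ sumℕ (c ∘ suc))))
    (trans (cong (λ z → ℤ.+ a ℤ.+ z) (sumℤ-+ a (c ∘ suc))) (sym (ℤ.pos-+ a (ℓ * a))))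
    where
    regroup : ∀ x y s t → (x ℤ.- y) ℤ.+ s ℤ.+ (y ℤ.+ t) ≡ x ℤ.+ (s ℤ.+ t)
    regroup = ℤ-Solver.solve-∀

  module _ {ℓ : ℕ} (a : ℕ) (c : Fin ℓ → ℕ) where

    private
      diff : Fin ℓ → ℤ
      diff i = ℤ.+ a ℤ.- ℤ.+ c i

    sumℤ-≤⁻ : ∀ {N} → sumℤ diff ℤ.≤ ℤ.+ N → ℓ * a ≤ N + sumℕ c
    sumℤ-≤⁻ {N} h = ℤ.drop‿+≤+ (subst₂ ℤ._≤_ (sumℤ-+ a c) (sym (ℤ.pos-+ N (sumℕ c))) (ℤ.+-monoˡ-≤ (ℤ.+ sumℕ c) h))

    sumℤ-≤⁺ : ∀ {N} → ℓ * a ≤ N + sumℕ c → sumℤ diff ℤ.≤ ℤ.+ N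
    sumℤ-≤⁺ {N} h = subst₂ ℤ._≤_ (cancel (sumℤ diff) (ℤ.+ sumℕ c)) (cancel (ℤ.+ N) (ℤ.+ sumℕ c))
      (ℤ.+-monoˡ-≤ (ℤ.- (ℤ.+ sumℕ c)) (subst₂ ℤ._≤_ (sym (sumℤ-+ a c)) (ℤ.pos-+ N (sumℕ c)) (ℤ.+≤+ h)))
      where
      cancel : ∀ x y → (x ℤ.+ y) ℤ.+ ℤ.- y ≡ x
      cancel = ℤ-Solver.solve-∀

  -- Reachability and rank in a matroid-rooted mixed hypergraph.

  module Rooted {n : ℕ} (H : MixedHypergraph n) (R : Subset n) (M : Matroid R) (rooted : IsMatroidRooted H R) where

    E : Fin n → Fin n → Set
    E = Step H

    E? : ∀ u w → Dec (E u w)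
    E? u w = any? (λ a → (u ∈? tl H a) ×-dec (hd H a ≟ w))
      ⊎-dec any? (λ e → (u ∈? he H e) ×-dec (w ∈? he H e) ×-dec ¬? (u ≟ w))

    heEnters-root : ∀ {r e u} → r ∈ R → r ∈ he H e → u ∈ he H e → u ≡ r
    heEnters-root {r} {e} {u} r∈R r∈e u∈e with u ≟ r
    ... | yes u≡r = u≡r
    ... | no u≢r = true≢false
      (∧-true⁺ (meets⁺ r∈e (x∈⁅x⁆ r)) (meets⁺ u∈e (x∉p⇒x∈∁p λ u∈ → u≢r (x∈⁅y⁆⇒x≡y r u∈))))
      (proj₁ (proj₂ (rooted r r∈R)) e)

    E-∉R : ∀ {u w} → E u w → w ∉ R
    E-∉R {u} (inj₁ (a , u∈ , refl)) w∈R = true≢false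
      (∧-true⁺ (∈ᵇ⁺ (x∈⁅x⁆ (hd H a))) (meets⁺ u∈ (x∉p⇒x∈∁p λ u∈h →
        hd∉tl H a (subst (_∈ tl H a) (x∈⁅y⁆⇒x≡y _ u∈h) u∈))))
      (proj₁ (rooted (hd H a) w∈R) a)
    E-∉R (inj₂ (e , u∈ , w∈ , u≢w)) w∈R = u≢w (heEnters-root w∈R w∈ u∈)

    -- A dyperedge with `x` in its tail leaves the singleton of `x`, because its head is not in its
    -- tail.
    tl-root : ∀ {a x} → x ∈ R → x ∈ tl H a → tl H a ≡ ⁅ x ⁆
    tl-root {a} {x} x∈R x∈a = proj₂ (proj₂ (rooted x x∈R)) a
      (∧-true⁺ (∈ᵇ⁺ (x∉p⇒x∈∁p λ h∈ → hd∉tl H a (subst (_∈ tl H a) (sym (x∈⁅y⁆⇒x≡y x h∈)) x∈a)))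
               (meets⁺ x∈a (x∉p⇒x∈∁p λ x∈∁ → x∈p⇒x∉∁p (x∈⁅x⁆ x) x∈∁)))

    -- A tail with a non-root vertex contains no root, by `tl-root`, and neither does a hyperedge
    -- with a non-root vertex. So reachability between non-roots is unchanged when the roots are
    -- deleted.
    step-V : ∀ {u w} → u ∉ R → E u w → StepV H R u w
    step-V {u} u∉R (inj₁ (a , u∈ , refl)) = inj₁ (a , tl⊆ , x∉p⇒x∈∁p (E-∉R (inj₁ (a , u∈ , refl))) , u∈ , refl)
      where
      tl⊆ : tl H a ⊆ ∁ R
      tl⊆ {x} x∈ = x∉p⇒x∈∁p λ x∈R → u∉R (subst (_∈ R) (sym (x∈⁅y⁆⇒x≡y x (subst (u ∈_) (tl-root x∈R x∈) u∈))) x∈R)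
    step-V {u} u∉R (inj₂ (e , u∈ , w∈ , u≢w)) = inj₂ (e , he⊆ , u∈ , w∈ , u≢w)
      where
      he⊆ : he H e ⊆ ∁ R
      he⊆ x∈ = x∉p⇒x∈∁p λ x∈R → u∉R (subst (_∈ R) (sym (heEnters-root x∈R x∈ u∈)) x∈R)

    reach-V : ∀ {u w} → u ∉ R → Star E u w → ReachV H R u w
    reach-V u∉R ε = ε
    reach-V u∉R (e ◅ p) = step-V u∉R e ◅ reach-V (E-∉R e) p

    reach-∉R : ∀ {u w} → u ∉ R → Star E u w → w ∉ R
    reach-∉R u∉R ε = u∉R
    reach-∉R u∉R (e ◅ p) = reach-∉R (E-∉R e) p

    V-reach : ∀ {u w} → ReachV H R u w → Star E u w
    V-reach ε = ε
    V-reach (inj₁ (a , _ , _ , u∈ , h≡) ◅ p) = inj₁ (a , u∈ , h≡) ◅ V-reach p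
    V-reach (inj₂ (e , _ , u∈ , w∈ , u≢w) ◅ p) = inj₂ (e , u∈ , w∈ , u≢w) ◅ V-reach p

    -- Defined on all vertex sets because bisets are encoded by outer sets: inner sets avoid `R`, so
    -- outer set and wall have the same rank.
    ρ : Subset n → ℕ
    ρ X = rank M (X ∩ R)

    ρ-mono : ∀ {X Y} → X ⊆ Y → ρ X ≤ ρ Y
    ρ-mono {X} {Y} s = rank-mono M (X ∩ R) (Y ∩ R) (p∩q⊆q Y R) λ x∈ → let p , q = ∩⁻ x∈ in x∈p∩q⁺ (s p , q)

    ρ-submod : ∀ X Y → ρ (X ∪ Y) + ρ (X ∩ Y) ≤ ρ X + ρ Y
    ρ-submod X Y = ≤-trans (+-mono-≤
        (rank-mono M _ _ (λ x∈ → [ p∩q⊆q X R , p∩q⊆q Y R ]′ (∪⁻ x∈))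
          λ x∈ → let p , q = ∩⁻ x∈ in
            [ (λ x∈X → p⊆p∪q _ (x∈p∩q⁺ (x∈X , q))) , (λ x∈Y → q⊆p∪q (X ∩ R) _ (x∈p∩q⁺ (x∈Y , q))) ]′ (∪⁻ p))
        (rank-mono M _ _ (λ x∈ → p∩q⊆q X R (p∩q⊆p _ _ x∈))
          λ x∈ → let p , q = ∩⁻ x∈ ; x∈X , x∈Y = ∩⁻ p in x∈p∩q⁺ (x∈p∩q⁺ (x∈X , q) , x∈p∩q⁺ (x∈Y , q))))
      (rank-submod M (X ∩ R) (Y ∩ R) (p∩q⊆q X R) (p∩q⊆q Y R))

    ρ-∩R : ∀ X → ρ X ≤ ρ (X ∩ R)
    ρ-∩R X = rank-mono M _ _ (p∩q⊆q (X ∩ R) R) λ x∈ → x∈p∩q⁺ (x∈ , p∩q⊆q X R x∈)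

    ρ-rank : ∀ {X} → X ⊆ R → ρ X ≡ rank M X
    ρ-rank {X} s = cong (rank M) (⊆-antisym (p∩q⊆p X R) λ x∈ → x∈p∩q⁺ (x∈ , s x∈))

    Condition : Set
    Condition = ∀ (C : Subset n) → IsSCC H R C → ∀ (B : BisetSubpartition C) →
      (∀ i v → InP H (XW B i) v ⇔ v ∈ XW B i) →
      ∀ (PC : Subset n) → IsPcapR H R C PC →
      sumℤ (λ i → ℤ.+ rank M PC ℤ.- ℤ.+ rank M (XW B i ∩ R))
        ℤ.≤ ℤ.+ (eE H (XI B) + sumℕ (λ i → dIn H (XO B i) (XI B i)))

  -- Sufficiency: construction of the packing.

  module Sufficiency {n : ℕ} (H : MixedHypergraph n) (R : Subset n) (M : Matroid R) (rooted : IsMatroidRooted H R)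
    (condition : Rooted.Condition H R M rooted) where

    open Rooted H R M rooted
    open Components E E? R ρ
    open Orientation E E? R ρ

    component-SCC : ∀ v → v ∉ R → IsSCC H R (C v)
    component-SCC v v∉R =
      (v , v∈Cv v) ,
      (λ w∈ → x∉p⇒x∈∁p (C-∉R w∈)) ,
      (λ u w u∈ w∈ → reach-V (C-∉R u∈) (proj₁ (C⁻ u∈) ◅◅ proj₂ (C⁻ w∈))) ,
      (λ u w u∈ _ p q → C⁺ (V-reach q ◅◅ proj₁ (C⁻ u∈)) (proj₂ (C⁻ u∈) ◅◅ V-reach p))
      where
      C-∉R : ∀ {w} → w ∈ C v → w ∉ R
      C-∉R w∈ = reach-∉R v∉R (proj₂ (C⁻ w∈))

    dyWeight : Weight
    dyWeight D X = count (λ a → enters (tl H a) (hd H a) D X)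

    weight : Weight
    weight D X = dyWeight D X + ρ X

    weight-submodular : Submodular weight
    weight-submodular D X Y = +-exchange-≤ {dyWeight D (X ∪ Y)} {dyWeight D (X ∩ Y)} {dyWeight D X} {dyWeight D Y}
      (count-exchange {p = into (X ∪ Y)} {into (X ∩ Y)} {into X} {into Y}
        (λ a → enters-submod (tl H a) (hd H a) D X Y))
      (ρ-submod X Y)
      where
      into : Subset n → Fin (nA H) → Bool
      into Z a = enters (tl H a) (hd H a) D Z

    -- The list becomes a biset subpartition with outer sets `X` and inner sets `X ∩ D`.
    -- Admissibility makes the walls closed, and the subtracted ranks move to the other side.
    covered : Covered (he H) weight
    covered v v∉R L aL dL = begin
      length L * k v
        ≤⟨ sumℤ-≤⁻ (rank M (P v ∩ R)) (λ i → rank M (XW B i ∩ R))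
             (condition D (component-SCC v v∉R) B closed (P v ∩ R) reach) ⟩
      (eE H (XI B) + sumℕ (λ i → dIn H (XO B i) (XI B i))) + sumℕ (λ i → rank M (XW B i ∩ R))
        ≤⟨ +-monoʳ-≤ _ (sumℕ-mono λ i → ρ-mono {XW B i} (p─q⊆p (XO B i) (XI B i))) ⟩
      (eE H (XI B) + sumℕ (λ i → dyWeight D (List.lookup L i))) + sumℕ (λ i → ρ (List.lookup L i))
        ≡⟨ +-assoc (eE H (XI B)) _ _ ⟩
      eE H (XI B) + (sumℕ (λ i → dyWeight D (List.lookup L i)) + sumℕ (λ i → ρ (List.lookup L i)))
        ≡⟨ cong₂ _+_ (count-cong λ e → any-lookup (λ X → crosses (he H e) (X ∩ D)) L)
             (trans (cong₂ _+_ (sum-lookup (dyWeight D) L) (sum-lookup ρ L)) (sym (sum-map-+ (dyWeight D) ρ L))) ⟩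
      count (λ e → crossesSome (he H e) D L) + sum (map (weight D) L) ∎
      where
      open ≤-Reasoning
      D : Subset n
      D = C v
      member : Fin (length L) → Subset n
      member = List.lookup L
      swap : ∀ X Y → DisjointOn D X Y → DisjointOn D Y X
      swap _ _ d x∈D x∈Y x∈X = d x∈D x∈X x∈Y
      admissible : ∀ i → Admissible D (member i)
      admissible i = All.lookup aL (∈-lookup {xs = L} i)
      B : BisetSubpartition D
      B = record
        { ℓ = length L ; XO = member ; XI = λ i → member i ∩ D
        ; XI⊆XO = λ i → p∩q⊆p (member i) D
        ; XI-ne = λ i → let x , p = proj₁ (admissible i) in x , x∈p∩q⁺ p
        ; XI⊆C = λ i → p∩q⊆q (member i) D
        ; XI-disj = λ i j i≢j x x∈ x∈′ → let x∈i , x∈D = ∩⁻ x∈ in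
            AllPairs-lookup {_~_ = DisjointOn D} {L} (λ {X} {Y} → swap X Y) dL i j i≢j x∈D x∈i (proj₁ (∩⁻ x∈′))
        ; XW⊆∁C = λ i x∈ → let x∈i , x∉ = ─⁻ x∈ in x∉p⇒x∈∁p λ x∈D → x∉ (x∈p∩q⁺ (x∈i , x∈D)) }
      wall⁻ : ∀ i {x} → x ∈ XW B i → x ∈ member i × x ∉ D
      wall⁻ i x∈ = let x∈i , x∉ = ─⁻ x∈ in x∈i , λ x∈D → x∉ (x∈p∩q⁺ (x∈i , x∈D))
      wall⁺ : ∀ i {x} → x ∈ member i × x ∉ D → x ∈ XW B i
      wall⁺ i (x∈ , x∉D) = x∈p∧x∉q⇒x∈p─q x∈ λ x∈∩ → x∉D (proj₂ (∩⁻ {X = member i} x∈∩))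
      back : ∀ i {u x} → Star E u x → x ∈ XW B i → u ∈ XW B i
      back i ε x∈ = x∈
      back i (e ◅ p) x∈ = let w∈ , w∉ = wall⁻ i (back i p x∈) in wall⁺ i (proj₂ (admissible i) _ _ e w∈ w∉)
      closed : ∀ i u → InP H (XW B i) u ⇔ u ∈ XW B i
      closed i u = mk⇔ (λ { (x , x∈ , p) → back i p x∈ }) (λ u∈ → u , u∈ , ε)
      reach : IsPcapR H R D (P v ∩ R)
      reach u = mk⇔ (λ u∈ → let u∈P , u∈R = ∩⁻ u∈ in u∈R , v , v∈Cv v , P⁻ u∈P)
                    (λ { (u∈R , x , x∈ , p) → x∈p∩q⁺ (P⁺ (p ◅◅ proj₁ (C⁻ x∈)) , u∈R) })

    -- Distinct vertices of a hyperedge reach each other in one step. A root is excluded, since its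
    -- hyperedge would have only one vertex.
    he-component : ∀ e → InComponent (he H e)
    he-component e with nonempty? (he H e)
    ... | no empty = ⊥-elim (1+n≰n {0} (≤-trans (≤-trans (n≤1+n 1) (he-size H e))
          (≤-reflexive (trans (cong ∣_∣ (Empty-unique empty)) (∣⊥∣≡0 n)))))
    ... | yes (x , x∈) = x , x∈ , x∉R , λ {y} y∈ → inside y∈ (x ≟ y)
      where
      inside : ∀ {y} → y ∈ he H e → Dec (x ≡ y) → y ∈ C x
      inside y∈ (yes refl) = v∈Cv x
      inside y∈ (no x≢y) = C⁺ (inj₂ (e , y∈ , x∈ , x≢y ∘ sym) ◅ ε) (inj₂ (e , x∈ , y∈ , x≢y) ◅ ε)
      x∉R : x ∉ R
      x∉R x∈R = 1+n≰n (≤-trans (he-size H e) (≤-trans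
        (p⊆q⇒∣p∣≤∣q∣ (λ {y} y∈ → subst (_∈ ⁅ x ⁆) (sym (heEnters-root x∈R x∈ y∈)) (x∈⁅x⁆ x)))
        (≤-reflexive (∣⁅x⁆∣≡1 x))))

    private
      abstract
        orientation : ∃[ h ] ((∀ i → h i ∈ he H i) × Oriented (he H) weight h)
        orientation = orient (he H) weight weight-submodular covered he-component

      h : Fin (nE H) → Fin n
      h = proj₁ orientation

      h∈ : ∀ i → h i ∈ he H i
      h∈ = proj₁ (proj₂ orientation)

      -- The dyperedges used by the growth: those of `H`, then the hyperedges with their chosen
      -- heads, each with the whole hyperedge as tail.
      tail : Fin (nA H + nE H) → Subset n
      tail i = [ tl H , he H ]′ (splitAt (nA H) i)

      head : Fin (nA H + nE H) → Fin n
      head i = [ hd H , h ]′ (splitAt (nA H) i)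

      tail-reach : ∀ i {u} → u ∈ tail i → Star E u (head i)
      tail-reach i {u} u∈ with splitAt (nA H) i
      ... | inj₁ a = inj₁ (a , u∈ , refl) ◅ ε
      ... | inj₂ e with u ≟ h e
      ... | yes refl = ε
      ... | no u≢h = inj₂ (e , u∈ , h∈ e , u≢h) ◅ ε

      open Growth E E? R ρ ρ-mono ρ-submod ρ-∩R E-∉R tail head tail-reach

      oriented-count : ∀ D X → count (λ i → enters (tail i) (head i) D X)
        ≡ dyWeight D X + count (λ e → enters (he H e) (h e) D X)
      oriented-count D X = trans (count-↑ (nA H) (λ i → enters (tail i) (head i) D X)) (cong₂ _+_
        (count-cong λ a → cong (λ s → enters ([ tl H , he H ]′ s) ([ hd H , h ]′ s) D X) (splitAt-↑ˡ (nA H) a (nE H)))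
        (count-cong λ e → cong (λ s → enters ([ tl H , he H ]′ s) ([ hd H , h ]′ s) D X) (splitAt-↑ʳ (nA H) (nE H) e)))

      abstract
        completed : Complete
        completed = complete λ v v∉R X aX → ≤-trans (proj₂ (proj₂ orientation) v v∉R X aX)
          (≤-reflexive (trans (rearrange (dyWeight (C v) X) (ρ X) _) (cong (_+ ρ X) (sym (oriented-count (C v) X)))))
          where
          rearrange : ∀ x y z → (x + y) + z ≡ (x + z) + y
          rearrange = solve-∀

      α : Assignment
      α = proj₁ completed

      S : Fin n → Subset n
      S = proj₁ (proj₂ completed)

      built : Built α S
      built = proj₁ (proj₂ (proj₂ completed))

      saturated : ∀ v → v ∉ R → k v ≤ ρ (S v)
      saturated = proj₂ (proj₂ (proj₂ completed))

      dy : Fin (nA H) → Maybe (Fin n × Fin n)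
      dy a = α (a ↑ˡ nE H)

      withHead : Fin n → Fin n × Fin n → Fin n × Fin n × Fin n
      withHead v (r , u) = r , u , v

      hy : Fin (nE H) → Maybe (Fin n × Fin n × Fin n)
      hy e = Maybe.map (withHead (h e)) (α (nA H ↑ʳ e))

      pick-hy : ∀ r v x → pick r v x ≡ pick₃ r (Maybe.map (withHead v) x)
      pick-hy r v nothing = refl
      pick-hy r v (just _) = refl

      arcs≡rootArcs : ∀ r → arcs α r ≡ rootArcs H dy hy r
      arcs≡rootArcs r = trans (collect-↑ (nA H) (λ i → pick r (head i) (α i))) (trans (cong₂ _++_
        (collect-cong λ a → cong (λ s → pick r ([ hd H , h ]′ s) (dy a)) (splitAt-↑ˡ (nA H) a (nE H)))
        (collect-cong λ e → trans
          (cong (λ s → pick r ([ hd H , h ]′ s) (α (nA H ↑ʳ e))) (splitAt-↑ʳ (nA H) (nE H) e))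
          (pick-hy r (h e) (α (nA H ↑ʳ e)))))
        (sym (rootArcs-collect H dy hy r)))

      roots-at : ∀ v → tabulate (λ r → (r ∈ᵇ R) ∧ (v ∈ᵇ span S r)) ≡ S v
      roots-at v = ⊆-antisym
        (λ {r} r∈ → span⁻ S r (∈ᵇ⁻ (proj₂ (∧-true⁻ (r ∈ᵇ R) _
          (trans (sym (lookup∘tabulate (λ r → (r ∈ᵇ R) ∧ (v ∈ᵇ span S r)) r)) (∈ᵇ⁺ r∈))))))
        (λ {r} r∈ → ∈ᵇ⁻ (trans (lookup∘tabulate _ r) (∧-true⁺ (∈ᵇ⁺ (built-⊆R built r∈)) (∈ᵇ⁺ (span⁺ S r r∈)))))

    packing : Packing H R M
    packing = record
      { dyAssign = dy ; hyAssign = hy ; verts = span S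
      ; dy-valid = λ a r u e → let r∈ , u∈ , _ = built-assigned built (a ↑ˡ nE H) e in
          r∈ , subst (λ s → u ∈ [ tl H , he H ]′ s) (splitAt-↑ˡ (nA H) a (nE H)) u∈
      ; hy-valid = λ e r u v eq → hyper e r u v (α (nA H ↑ʳ e)) refl eq
      ; arb = λ r r∈R → subst (IsArborescence r (span S r)) (arcs≡rootArcs r) (built-arborescence built r∈R)
      ; basis = λ v v∉R Y isP → subst (λ Z → IsBasis M Z Y) (sym (roots-at v)) (isBasis v v∉R Y isP) }
      where
      hyper : ∀ e r u v x → α (nA H ↑ʳ e) ≡ x → Maybe.map (withHead (h e)) x ≡ just (r , u , v) →
        r ∈ R × u ∈ he H e × v ∈ he H e × u ≢ v
      hyper e r u v (just _) eq refl = let r∈ , u∈ , u≢ = built-assigned built (nA H ↑ʳ e) eq in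
        r∈ , subst (λ s → u ∈ [ tl H , he H ]′ s) split u∈ , h∈ e ,
        subst (λ s → u ≢ [ hd H , h ]′ s) split u≢
        where
        split : splitAt (nA H) {nE H} (nA H ↑ʳ e) ≡ inj₂ e
        split = splitAt-↑ʳ (nA H) (nE H) e
      -- Independence of `S v` comes from the growth, spanning from saturation.
      isBasis : ∀ v → v ∉ R → ∀ Y → IsPcapR H R ⁅ v ⁆ Y → IsBasis M (S v) Y
      isBasis v v∉R Y isP =
        S⊆Y ,
        ≤-antisym (≤-trans (built-independent built v∉R) (≤-reflexive (ρ-rank S⊆R))) (rank-≤ M (S v) S⊆R) ,
        ≤-antisym (rank-mono M (S v) Y Y⊆R S⊆Y)
          (≤-trans (rank-mono M Y (P v ∩ R) (p∩q⊆q (P v) R) Y⊆PR) (≤-trans (saturated v v∉R) (≤-reflexive (ρ-rank S⊆R))))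
        where
        S⊆R : S v ⊆ R
        S⊆R = built-⊆R built
        S⊆Y : S v ⊆ Y
        S⊆Y r∈ = Equivalence.from (isP _) (S⊆R r∈ , v , x∈⁅x⁆ v , P⁻ (built-⊆P built r∈))
        Y⊆R : Y ⊆ R
        Y⊆R r∈ = proj₁ (Equivalence.to (isP _) r∈)
        Y⊆PR : Y ⊆ P v ∩ R
        Y⊆PR {r} r∈ with Equivalence.to (isP r) r∈
        ... | r∈R , x , x∈ , p = x∈p∩q⁺ (P⁺ (subst (Star E r) (x∈⁅y⁆⇒x≡y v x∈) p) , r∈R)

  -- Directed paths in arborescences.

  module _ {A : Set} {T : A → A → Set} where

    last-step : ∀ {x z} → Star T x z → x ≡ z ⊎ ∃[ y ] (Star T x y × T y z)
    last-step ε = inj₁ refl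
    last-step (t ◅ p) with last-step p
    ... | inj₁ refl = inj₂ (_ , ε , t)
    ... | inj₂ (y , q , t′) = inj₂ (y , t ◅ q , t′)

    -- The initial part of the walk is kept: it later shows that the root reaches the tail of the
    -- crossing arc.
    crossing : {Q : A → Set} → (∀ x → Dec (Q x)) → ∀ {x z} → Star T x z → ¬ Q x → Q z →
      ∃[ y ] ∃[ y′ ] (Star T x y × T y y′ × ¬ Q y × Q y′)
    crossing Q? ε ¬q q = ⊥-elim (¬q q)
    crossing Q? (_◅_ {j = w} t p) ¬q q with Q? w
    ... | yes qw = _ , _ , ε , t , ¬q , qw
    ... | no ¬qw = let y , y′ , p′ , rest = crossing Q? p ¬qw q in y , y′ , t ◅ p′ , rest

  module _ {n : ℕ} {r : Fin n} {U : Subset n} {arcs : List (Arc n)} (arb : IsArborescence r U arcs) where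

    private
      Directed : Fin n → Fin n → Set
      Directed x y = (x , y) ∈ₗ arcs

      entering : ∀ x → List (Arc n)
      entering x = filter (λ p → proj₂ p ≟ x) arcs

      no-arc-to-root : ∀ {y} → ¬ Directed y r
      no-arc-to-root {y} a∈ with entering r | ∈-filter⁺ (λ p → proj₂ p ≟ r) a∈ refl | proj₁ (proj₂ (proj₂ (proj₂ (proj₂ arb))))
      ... | _ ∷ _ | _ | ()

      arc-unique : ∀ {x y z} → Directed x z → Directed y z → x ≡ y
      arc-unique {x} {y} {z} x∈ y∈ with z ≟ r
      ... | yes refl = ⊥-elim (no-arc-to-root x∈)
      ... | no z≢r
        with entering z | ∈-filter⁺ (λ p → proj₂ p ≟ z) x∈ refl | ∈-filter⁺ (λ p → proj₂ p ≟ z) y∈ refl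
           | proj₂ (proj₂ (proj₂ (proj₂ (proj₂ arb)))) z (proj₂ (proj₁ (proj₂ arb) x z x∈)) z≢r
      ... | _ ∷ [] | here refl | here refl | _ = refl

      -- A backward step along an arc into x must retrace the last arc of the directed path to x.
      directed : ∀ {x y} → Star Directed r x → Star (UAdj arcs) x y → Star Directed r y
      directed p ε = p
      directed p (inj₁ a ◅ q) = directed (p ◅◅ (a ◅ ε)) q
      directed p (inj₂ a ◅ q) with last-step p
      ... | inj₁ refl = ⊥-elim (no-arc-to-root a)
      ... | inj₂ (y , p′ , a′) with arc-unique a a′
      ... | refl = directed p′ q

    arborescence-path : ∀ {v} → v ∈ U → Star (λ x y → (x , y) ∈ₗ arcs) r v
    arborescence-path v∈ = directed ε (proj₁ (proj₂ (proj₂ arb)) _ v∈)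

  count-≤𝟙 : ∀ {m} {p : Fin m → Bool} b → (∀ i → p i ≡ true → b ≡ true) →
    (∀ i j → p i ≡ true → p j ≡ true → i ≡ j) → count p ≤ 𝟙 b
  count-≤𝟙 true f u = count-≤1 u
  count-≤𝟙 {p = p} false f u = ≤-reflexive (count-false λ i →
    [ (λ t → true≢false (f i t) refl) , (λ e → e) ]′ (true-or-false (p i)))

  -- Necessity: double counting of the entering arcs.

  module Necessity {n : ℕ} (H : MixedHypergraph n) (R : Subset n) (M : Matroid R) (rooted : IsMatroidRooted H R)
    (packing : Packing H R M) (C : Subset n) (scc : IsSCC H R C) (B : BisetSubpartition C)
    (closed : ∀ i v → InP H (XW B i) v ⇔ v ∈ XW B i)
    (PC : Subset n) (isPC : IsPcapR H R C PC) where

    open Rooted H R M rooted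
    open Packing packing

    private
      arcs : Fin n → List (Arc n)
      arcs r = rootArcs H dyAssign hyAssign r

      arc⁻ : ∀ r {x y} → (x , y) ∈ₗ arcs r →
        (∃[ a ] (dyAssign a ≡ just (r , x) × hd H a ≡ y)) ⊎ (∃[ e ] hyAssign e ≡ just (r , x , y))
      arc⁻ r p∈ rewrite rootArcs-collect H dyAssign hyAssign r
        with ∈-++⁻ (collect (λ a → pick r (hd H a) (dyAssign a))) p∈
      ... | inj₁ q = let a , e = ∈-collect⁻ (λ a → pick r (hd H a) (dyAssign a)) q in inj₁ (a , fromDy (dyAssign a) refl e)
        where
        fromDy : ∀ {a x y} z → dyAssign a ≡ z → pick r (hd H a) z ≡ just (x , y) → dyAssign a ≡ just (r , x) × hd H a ≡ y
        fromDy z eq e with pick⁻ z e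
        ... | u , refl , refl = eq , refl
      ... | inj₂ q = let e , eq = ∈-collect⁻ (λ e → pick₃ r (hyAssign e)) q in inj₂ (e , fromHy (hyAssign e) refl eq)
        where
        fromHy : ∀ {e x y} z → hyAssign e ≡ z → pick₃ r z ≡ just (x , y) → hyAssign e ≡ just (r , x , y)
        fromHy z eq e with pick₃⁻ z e
        ... | u , v , refl , refl = eq

      arcs-reach : ∀ r {x y} → Star (λ x y → (x , y) ∈ₗ arcs r) x y → Star E x y
      arcs-reach r ε = ε
      arcs-reach r (a ◅ p) with arc⁻ r a
      ... | inj₁ (a′ , eq , refl) = inj₁ (a′ , proj₂ (dy-valid a′ _ _ eq) , refl) ◅ arcs-reach r p
      ... | inj₂ (e , eq) = let _ , u∈ , v∈ , u≢v = hy-valid e _ _ _ eq in inj₂ (e , u∈ , v∈ , u≢v) ◅ arcs-reach r p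

      C-∉R : ∀ {v} → v ∈ C → v ∉ R
      C-∉R v∈ = x∈∁p⇒x∉p (proj₁ (proj₂ scc) v∈)

      -- The charging of the double count: a root pays with an arc of its own tree that enters the
      -- biset.
      dyUse : Subset n → Subset n → Fin n → Maybe (Fin n × Fin n) → Fin n → Bool
      dyUse O I h nothing r = false
      dyUse O I h (just (r′ , u)) r = does (r′ ≟ r) ∧ ((h ∈ᵇ I) ∧ not (u ∈ᵇ O))

      hyUse : Subset n → Subset n → Maybe (Fin n × Fin n × Fin n) → Fin n → Bool
      hyUse O I nothing r = false
      hyUse O I (just (r′ , u , v)) r = does (r′ ≟ r) ∧ ((v ∈ᵇ I) ∧ not (u ∈ᵇ O))

      not-∈ᵇ : ∀ {u} {O : Subset n} → not (u ∈ᵇ O) ≡ true → u ∉ O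
      not-∈ᵇ e u∈ rewrite ∈ᵇ⁺ u∈ with () ← e

      not-∈ᵇ⁺ : ∀ {u} {O : Subset n} → u ∉ O → not (u ∈ᵇ O) ≡ true
      not-∈ᵇ⁺ {u} {O} u∉ with u ∈ᵇ O in eq
      ... | true = ⊥-elim (u∉ (∈ᵇ⁻ eq))
      ... | false = refl

      own : ∀ (r : Fin n) {b} → b ≡ true → does (r ≟ r) ∧ b ≡ true
      own r e rewrite dec-true (r ≟ r) refl = e

      dyUse⁻ : ∀ O I h x r → dyUse O I h x r ≡ true → ∃[ u ] (x ≡ just (r , u) × h ∈ I × u ∉ O)
      dyUse⁻ O I h (just (r′ , u)) r e with r′ ≟ r
      ... | yes refl = let p , q = ∧-true⁻ (h ∈ᵇ I) _ e in u , refl , ∈ᵇ⁻ p , not-∈ᵇ q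

      hyUse⁻ : ∀ O I x r → hyUse O I x r ≡ true → ∃[ u ] ∃[ v ] (x ≡ just (r , u , v) × v ∈ I × u ∉ O)
      hyUse⁻ O I (just (r′ , u , v)) r e with r′ ≟ r
      ... | yes refl = let p , q = ∧-true⁻ (v ∈ᵇ I) _ e in u , v , refl , ∈ᵇ⁻ p , not-∈ᵇ q

      module Member (i : Fin (ℓ B)) where

        v : Fin n
        v = proj₁ (XI-ne B i)

        v∈XI : v ∈ XI B i
        v∈XI = proj₂ (XI-ne B i)

        v∈C : v ∈ C
        v∈C = XI⊆C B i v∈XI

        Z : Subset n
        Z = tabulate (λ r → (r ∈ᵇ R) ∧ (v ∈ᵇ verts r))

        Z⁻ : ∀ {r} → r ∈ Z → r ∈ R × v ∈ verts r
        Z⁻ {r} r∈ = let p , q = ∧-true⁻ (r ∈ᵇ R) _ (trans (sym (lookup∘tabulate _ r)) (∈ᵇ⁺ r∈)) in ∈ᵇ⁻ p , ∈ᵇ⁻ q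

        -- All vertices of `C` reach each other, so `PC` is also the set of roots that reach `v`.
        isBasis : IsBasis M Z PC
        isBasis = basis v (C-∉R v∈C) PC λ u → mk⇔
          (λ u∈ → let u∈R , x , x∈ , p = Equivalence.to (isPC u) u∈ in
            u∈R , v , x∈⁅x⁆ v , p ◅◅ V-reach (proj₁ (proj₂ (proj₂ scc)) x v x∈ v∈C))
          (λ { (u∈R , x , x∈ , p) → Equivalence.from (isPC u) (u∈R , v , v∈C , subst (Star E u) (x∈⁅y⁆⇒x≡y v x∈) p) })

        -- `Z` has the rank of `PC`. Its part in the wall has at most the rank of the wall's roots,
        -- the rest at most its own size.
        rank-split : rank M PC ≤ ∣ Z ─ XW B i ∣ + rank M (XW B i ∩ R)
        rank-split = begin
          rank M PC                                         ≡⟨ proj₂ (proj₂ isBasis) ⟨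
          rank M Z                                          ≤⟨ rank-mono M Z (A ∪ W) A∪W⊆R Z⊆ ⟩
          rank M (A ∪ W)                                    ≤⟨ m≤m+n _ _ ⟩
          rank M (A ∪ W) + rank M (A ∩ W)                   ≤⟨ rank-submod M A W A⊆R W⊆R ⟩
          rank M A + rank M W                               ≤⟨ +-monoˡ-≤ _ (rank-≤ M A A⊆R) ⟩
          ∣ A ∣ + rank M W                                  ∎
          where
          open ≤-Reasoning
          A W : Subset n
          A = Z ─ XW B i
          W = XW B i ∩ R
          A⊆R : A ⊆ R
          A⊆R x∈ = proj₁ (Z⁻ (p─q⊆p Z (XW B i) x∈))
          W⊆R : W ⊆ R
          W⊆R = p∩q⊆q (XW B i) R
          A∪W⊆R : A ∪ W ⊆ R
          A∪W⊆R x∈ = [ A⊆R , W⊆R ]′ (∪⁻ x∈)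
          Z⊆ : Z ⊆ A ∪ W
          Z⊆ {x} x∈ with x ∈? XW B i
          ... | yes x∈W = q⊆p∪q A W (x∈p∩q⁺ (x∈W , proj₁ (Z⁻ x∈)))
          ... | no x∉W = p⊆p∪q W (x∈p∧x∉q⇒x∈p─q x∈ x∉W)

        dyUsed : Fin (nA H) → Fin n → Bool
        dyUsed a r = dyUse (XO B i) (XI B i) (hd H a) (dyAssign a) r

        hyUsed : Fin (nE H) → Fin n → Bool
        hyUsed e r = hyUse (XO B i) (XI B i) (hyAssign e) r

        used : ∀ r → (r ∈ᵇ (Z ─ XW B i)) ≡ true → 1 ≤ count (λ a → dyUsed a r) + count (λ e → hyUsed e r)
        used r e with ─⁻ {X = Z} (∈ᵇ⁻ e)
        ... | r∈Z , r∉W with crossing (_∈? XI B i) (arborescence-path (arb r (proj₁ (Z⁻ r∈Z))) (proj₂ (Z⁻ r∈Z)))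
               (λ r∈I → C-∉R (XI⊆C B i r∈I) (proj₁ (Z⁻ r∈Z))) v∈XI
        ... | x , y , p , a , x∉I , y∈I = located (arc⁻ r a)
          where
          x∉O : x ∉ XO B i
          -- Otherwise `x` is in the wall, and so is `r`, which reaches `x`, because the wall is
          -- closed.
          x∉O x∈O = r∉W (Equivalence.to (closed i r) (x , x∈p∧x∉q⇒x∈p─q x∈O x∉I , arcs-reach r p))
          located : (∃[ a ] (dyAssign a ≡ just (r , x) × hd H a ≡ y)) ⊎ (∃[ e ] hyAssign e ≡ just (r , x , y)) →
            1 ≤ count (λ a → dyUsed a r) + count (λ e → hyUsed e r)
          located (inj₁ (a , eq , refl)) = ≤-trans (count-positive a
            (trans (cong (λ z → dyUse (XO B i) (XI B i) (hd H a) z r) eq) (own r (∧-true⁺ (∈ᵇ⁺ y∈I) (not-∈ᵇ⁺ x∉O))))) (m≤m+n _ _)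
          located (inj₂ (e , eq)) = ≤-trans (count-positive e
            (trans (cong (λ z → hyUse (XO B i) (XI B i) z r) eq) (own r (∧-true⁺ (∈ᵇ⁺ y∈I) (not-∈ᵇ⁺ x∉O))))) (m≤n+m _ _)

        hyUsedBySome : Fin (nE H) → Bool
        hyUsedBySome e = anyFin (hyUsed e)

        dy-bound : ∀ a → count (dyUsed a) ≤ 𝟙 ((hd H a ∈ᵇ XI B i) ∧ meetsᵇ (tl H a) (∁ (XO B i)))
        dy-bound a = count-≤𝟙 _
          (λ r e → let u , eq , h∈ , u∉ = dyUse⁻ (XO B i) (XI B i) (hd H a) (dyAssign a) r e in
            ∧-true⁺ (∈ᵇ⁺ h∈) (meets⁺ (proj₂ (dy-valid a r u eq)) (x∉p⇒x∈∁p u∉)))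
          (λ r r′ e e′ → same (dyUse⁻ (XO B i) (XI B i) (hd H a) (dyAssign a) r e)
                              (dyUse⁻ (XO B i) (XI B i) (hd H a) (dyAssign a) r′ e′))
          where
          same : ∀ {r r′} → ∃[ u ] (dyAssign a ≡ just (r , u) × hd H a ∈ XI B i × u ∉ XO B i) →
            ∃[ u ] (dyAssign a ≡ just (r′ , u) × hd H a ∈ XI B i × u ∉ XO B i) → r ≡ r′
          same (u , eq , _) (u′ , eq′ , _) with trans (sym eq) eq′
          ... | refl = refl

        -- Only use by this one biset is recorded here; that a hyperedge is not charged by several
        -- bisets is settled in `hyper-bound`.
        hy-bound : ∀ e → count (hyUsed e) ≤ 𝟙 (hyUsedBySome e)
        hy-bound e = count-≤𝟙 _ (λ r t → anyFin⁺ (hyUsed e) r t)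
          (λ r r′ t t′ → same (hyUse⁻ (XO B i) (XI B i) (hyAssign e) r t) (hyUse⁻ (XO B i) (XI B i) (hyAssign e) r′ t′))
          where
          same : ∀ {r r′} → ∃[ u ] ∃[ v ] (hyAssign e ≡ just (r , u , v) × v ∈ XI B i × u ∉ XO B i) →
            ∃[ u ] ∃[ v ] (hyAssign e ≡ just (r′ , u , v) × v ∈ XI B i × u ∉ XO B i) → r ≡ r′
          same (u , v , eq , _) (u′ , v′ , eq′ , _) with trans (sym eq) eq′
          ... | refl = refl

        -- Every root of `Z` outside the wall uses an arc entering the biset, and each dyperedge or
        -- hyperedge serves at most one root.
        roots-bound : ∣ Z ─ XW B i ∣ ≤ dIn H (XO B i) (XI B i) + count hyUsedBySome
        roots-bound = begin
          ∣ Z ─ XW B i ∣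
            ≡⟨ trans (card≡count (Z ─ XW B i)) (count≡sumℕ (_∈ᵇ (Z ─ XW B i))) ⟩
          sumℕ (λ r → 𝟙 (r ∈ᵇ (Z ─ XW B i)))
            ≤⟨ sumℕ-mono (λ r → bound r (true-or-false (r ∈ᵇ (Z ─ XW B i)))) ⟩
          sumℕ (λ r → count (λ a → dyUsed a r) + count (λ e → hyUsed e r))
            ≡⟨ sumℕ-+ (λ r → count (λ a → dyUsed a r)) (λ r → count (λ e → hyUsed e r)) ⟩
          sumℕ (λ r → count (λ a → dyUsed a r)) + sumℕ (λ r → count (λ e → hyUsed e r))
            ≡⟨ cong₂ _+_ (sumℕ-count-swap (λ r a → dyUsed a r)) (sumℕ-count-swap (λ r e → hyUsed e r)) ⟩
          sumℕ (λ a → count (dyUsed a)) + sumℕ (λ e → count (hyUsed e))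
            ≤⟨ +-mono-≤ (sumℕ-mono dy-bound) (sumℕ-mono hy-bound) ⟩
          sumℕ (λ a → 𝟙 ((hd H a ∈ᵇ XI B i) ∧ meetsᵇ (tl H a) (∁ (XO B i)))) + sumℕ (𝟙 ∘ hyUsedBySome)
            ≡⟨ cong₂ _+_ (sym (count≡sumℕ (λ a → (hd H a ∈ᵇ XI B i) ∧ meetsᵇ (tl H a) (∁ (XO B i)))))
                         (sym (count≡sumℕ hyUsedBySome)) ⟩
          dIn H (XO B i) (XI B i) + count hyUsedBySome ∎
          where
          open ≤-Reasoning
          bound : ∀ r → (r ∈ᵇ (Z ─ XW B i)) ≡ true ⊎ (r ∈ᵇ (Z ─ XW B i)) ≡ false →
            𝟙 (r ∈ᵇ (Z ─ XW B i)) ≤ count (λ a → dyUsed a r) + count (λ e → hyUsed e r)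
          bound r (inj₁ t) = ≤-trans (𝟙≤1 _) (used r t)
          bound r (inj₂ f) rewrite f = z≤n

      open Member using (hyUsedBySome)

      -- A trimmed hyperedge has a single head and the inner sets are disjoint, so it is charged by
      -- at most one member of the subpartition.
      hyper-bound : ∀ e → count (λ i → hyUsedBySome i e) ≤ 𝟙 (anyFin (λ i → heEntersᵇ H e (XI B i)))
      hyper-bound e = count-≤𝟙 _ (λ i t → anyFin⁺ (λ j → heEntersᵇ H e (XI B j)) i (entersXI i (user i t)))
        (λ i j t t′ → same i j (user i t) (user j t′))
        where
        User : Fin (ℓ B) → Set
        User i = ∃[ r ] ∃[ u ] ∃[ v ] (hyAssign e ≡ just (r , u , v) × v ∈ XI B i × u ∉ XO B i)
        user : ∀ i → hyUsedBySome i e ≡ true → User i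
        user i t = let r , t′ = anyFin⁻ (Member.hyUsed i e) t in r , hyUse⁻ (XO B i) (XI B i) (hyAssign e) r t′
        entersXI : ∀ i → User i → heEntersᵇ H e (XI B i) ≡ true
        entersXI i (r , u , v , eq , v∈I , u∉O) = let _ , u∈ , v∈ , _ = hy-valid e r u v eq in
          ∧-true⁺ (meets⁺ v∈ v∈I) (meets⁺ u∈ (x∉p⇒x∈∁p (u∉O ∘ XI⊆XO B i)))
        same : ∀ i j → User i → User j → i ≡ j
        same i j (_ , _ , v , eq , v∈ , _) (_ , _ , v′ , eq′ , v′∈ , _) with trans (sym eq) eq′
        ... | refl = decidable-stable (i ≟ j) λ i≢j → XI-disj B i j i≢j v v∈ v′∈

      sumℕ-const : ∀ m a → sumℕ {m} (λ _ → a) ≡ m * a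
      sumℕ-const zero a = refl
      sumℕ-const (suc m) a = cong (a +_) (sumℕ-const m a)

    bound : sumℤ (λ i → ℤ.+ rank M PC ℤ.- ℤ.+ rank M (XW B i ∩ R))
      ℤ.≤ ℤ.+ (eE H (XI B) + sumℕ (λ i → dIn H (XO B i) (XI B i)))
    bound = sumℤ-≤⁺ (rank M PC) (λ i → rank M (XW B i ∩ R)) (begin
      ℓ B * rank M PC
        ≡⟨ sumℕ-const (ℓ B) _ ⟨
      sumℕ {ℓ B} (λ _ → rank M PC)
        ≤⟨ sumℕ-mono (λ i → ≤-trans (Member.rank-split i) (+-monoˡ-≤ _ (Member.roots-bound i))) ⟩
      sumℕ (λ i → (d i + count (hyUsedBySome i)) + rank M (XW B i ∩ R))
        ≡⟨ trans (sumℕ-+ (λ i → d i + count (hyUsedBySome i)) _) (cong (_+ w) (sumℕ-+ d _)) ⟩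
      (sumℕ d + sumℕ (λ i → count (hyUsedBySome i))) + w
        ≡⟨ cong (λ z → (sumℕ d + z) + w) (sumℕ-count-swap hyUsedBySome) ⟩
      (sumℕ d + sumℕ (λ e → count (λ i → hyUsedBySome i e))) + w
        ≤⟨ +-monoˡ-≤ w (+-monoʳ-≤ (sumℕ d) (sumℕ-mono hyper-bound)) ⟩
      (sumℕ d + sumℕ (λ e → 𝟙 (anyFin (λ i → heEntersᵇ H e (XI B i))))) + w
        ≡⟨ cong (λ z → (sumℕ d + z) + w) (count≡sumℕ (λ e → anyFin (λ i → heEntersᵇ H e (XI B i)))) ⟨
      (sumℕ d + eE H (XI B)) + w
        ≡⟨ cong (_+ w) (+-comm (sumℕ d) _) ⟩
      (eE H (XI B) + sumℕ d) + w ∎)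
      where
      open ≤-Reasoning
      d : Fin (ℓ B) → ℕ
      d i = dIn H (XO B i) (XI B i)
      w : ℕ
      w = sumℕ (λ i → rank M (XW B i ∩ R))

open import Data.Integer using (+_; _-_; _≤_)

theorem11 : ∀ {n : ℕ} (H : MixedHypergraph n) (R : Subset n) (M : Matroid R) →
    IsMatroidRooted H R →
    Packing H R M
    ⇔ (∀ (C : Subset n) → IsSCC H R C →
    ∀ (B : BisetSubpartition C) →
    (∀ i v → InP H (XW B i) v ⇔ v ∈ XW B i) →
    ∀ (PC : Subset n) → IsPcapR H R C PC →
    sumℤ (λ i → + rank M PC - + rank M (XW B i ∩ R))
    ≤ + (eE H (XI B) +ℕ sumℕ (λ i → dIn H (XO B i) (XI B i))))
theorem11 H R M rooted = mk⇔
  (λ packing C scc B closed PC isPC → PackingTheory.Necessity.bound H R M rooted packing C scc B closed PC isPC)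
  (PackingTheory.Sufficiency.packing H R M rooted)
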